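{- For every composition $\alpha$ and every $s\ge0$, \[ \mathcal{Q}'_\alpha H_s = \sum_{\beta:\ \alpha\subset_s\beta} (1-q)^{n(\alpha,\beta)}\,\mathcal{Q}'_\beta, \] the sum over compositions $\beta$ with $\alpha\subset_s\beta$.
   Context: Work over $\mathbb{Q}(q)$. $\mathrm{NSym}$ is the free associative algebra on $H_1,H_2,\dots$ ($H_0=1$, $H_{ -r}=0$ for $r>0$), graded dual to $\mathrm{QSym}$ via $\langle H_{\alpha_1}\cdots H_{\alpha_k},M_\beta\rangle=\delta_{\alpha\beta}$ ($M_\beta$ monomial quasisymmetric functions), coproduct $\Delta(H_j)=\sum_iH_i\otimes H_{j-i}$; $\mathrm{NSym}[q]$ denotes its extension of scalars to $\mathbb{Q}(q)$. For $F\in\mathrm{QSym}$, $F^\perp$ satisfies $\langle F^\perp(H),G\rangle=\langle H,FG\rangle$ (extended linearly). $F_i=\sum_{\gamma\models i}M_\gamma$ ($F_0=1$) and $F_{1^i}=M_{1^i}$ are fundamental quasisymmetric functions. Let $\mathbb{B}_m=\sum_{i\ge0}(-1)^iH_{m+i}F_{1^i}^\perp$ and $\widetilde{\mathbb{B}}_m(f)=\sum_{i\ge0}q^i\,\mathbb{B}_{m+i}(F_i^\perp(f))$ for $m\in\mathbb{Z}$; for $\alpha\in\mathbb{Z}^m$ set $\mathcal{Q}'_\alpha=\widetilde{\mathbb{B}}_{\alpha_1}\cdots\widetilde{\mathbb{B}}_{\alpha_m}(1)$. For compositions, $\alpha\subset_s\beta$ means $|\beta|=|\alpha|+s$, $\alpha_j\le\beta_j$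 for all $j\le\ell(\alpha)$, and $\ell(\beta)\le\ell(\alpha)+1$. $n(\alpha,\beta)=|\{i\le\ell(\alpha):\alpha_i<\beta_i\}|$ is the number of rows of $\alpha$ strictly shorter than the same row of $\beta$. -}

module Defs where

open import Data.Nat using (ℕ; zero; suc; _∸_; _<_; _≤_; _<?_)
import Data.Nat as ℕ
open import Data.Integer using (ℤ; +_; -[1+_]; 0ℤ; 1ℤ; -1ℤ)
import Data.Integer as ℤ
open import Data.List using (List; []; _∷_; _++_; map; concatMap; upTo; replicate; length; filter)
open import Data.Nat.ListAction using (sum)
open import Data.List.Properties using (≡-dec)
open import Data.Product using (_×_; _,_)
open import Relation.Binary.PropositionalEquality using (_≡_)
open import Relation.Nullary using (yes; no)

-- Polynomials in q with integer coefficients (coefficient lists,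
-- constant term first).  All objects of the theorem have coefficients
-- in ℤ[q] ⊂ ℚ(q).

Poly : Set
Poly = List ℤ

0P : Poly
0P = []

1P : Poly
1P = 1ℤ ∷ []

-1P : Poly
-1P = -1ℤ ∷ []

qP : Poly
qP = 0ℤ ∷ 1ℤ ∷ []

_+P_ : Poly → Poly → Poly
[] +P r = r
(a ∷ p) +P [] = a ∷ p
(a ∷ p) +P (b ∷ r) = (a ℤ.+ b) ∷ (p +P r)

_*P_ : Poly → Poly → Poly
[] *P r = []
(a ∷ p) *P r = map (a ℤ.*_) r +P (0ℤ ∷ (p *P r))

_^P_ : Poly → ℕ → Poly
p ^P zero = 1P
p ^P suc n = p *P (p ^P n)

sumP : List Poly → Poly
sumP [] = 0P
sumP (p ∷ ps) = p +P sumP ps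

coeffP : Poly → ℕ → ℤ
coeffP [] n = 0ℤ
coeffP (a ∷ p) zero = a
coeffP (a ∷ p) (suc n) = coeffP p n

_≈P_ : Poly → Poly → Set
p ≈P r = ∀ n → coeffP p n ≡ coeffP r n

-- Words / compositions: lists of natural numbers.  A word w with
-- positive entries indexes the basis element H_w = H_{w1}⋯H_{wk}.

Word : Set
Word = List ℕ

_==W_ : Word → Word → Poly → Poly
(u ==W v) c with ≡-dec ℕ._≟_ u v
... | yes _ = c
... | no  _ = 0P

-- NSym[q]: finite formal ℤ[q]-linear combinations of the H_w.

NSym : Set
NSym = List (Poly × Word)

coeffN : NSym → Word → Poly
coeffN [] w = 0P
coeffN ((c , v) ∷ f) w = (v ==W w) c +P coeffN f w

_≈N_ : NSym → NSym → Set
f ≈N g = ∀ w → coeffN f w ≈P coeffN g w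

0N : NSym
0N = []

_+N_ : NSym → NSym → NSym
f +N g = f ++ g

sumN : List NSym → NSym
sumN [] = 0N
sumN (f ∷ fs) = f +N sumN fs

_·N_ : Poly → NSym → NSym
c ·N f = map (λ { (d , w) → (c *P d , w) }) f

_*N_ : NSym → NSym → NSym
f *N g = concatMap (λ { (c , u) → map (λ { (d , v) → (c *P d , u ++ v) }) g }) f

basis : Word → NSym
basis w = (1P , w) ∷ []

ext : (Word → NSym) → NSym → NSym
ext φ f = concatMap (λ { (c , w) → c ·N φ w }) f

H : ℤ → NSym
H (+ zero) = basis []
H (+ suc k) = basis (suc k ∷ [])
H -[1+ n ] = 0N

-- Coproduct: Δ(H_j) = Σ_i H_i ⊗ H_{j-i}, extended multiplicatively.
-- Δw w lists the terms H_u ⊗ H_v of Δ(H_w) (zero parts dropped as H_0 = 1).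

cons0 : ℕ → Word → Word
cons0 zero u = u
cons0 (suc k) u = suc k ∷ u

Δw : Word → List (Word × Word)
Δw [] = ([] , []) ∷ []
Δw (a ∷ w) = concatMap (λ i → map (λ { (u , v) → (cons0 i u , cons0 (a ∸ i) v) }) (Δw w))
                       (upTo (suc a))

-- QSym[q] in the monomial basis: formal combinations of M_β.

QSym : Set
QSym = List (Poly × Word)

pairW : Word → QSym → Poly
pairW u F = sumP (map (λ { (d , v) → (u ==W v) d }) F)

-- F^⊥(H) = Σ ⟨H_(1) , F⟩ H_(2)   (adjoint of multiplication by F)
perp : QSym → NSym → NSym
perp F f = concatMap (λ { (c , w) → map (λ { (u , v) → (c *P pairW u F , v) }) (Δw w) }) f

bumpHead : Word → Word
bumpHead [] = []
bumpHead (x ∷ xs) = suc x ∷ xs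

compsSuc : ℕ → List Word
compsSuc zero = (1 ∷ []) ∷ []
compsSuc (suc m) = map bumpHead (compsSuc m) ++ map (1 ∷_) (compsSuc m)

comps : ℕ → List Word
comps zero = [] ∷ []
comps (suc m) = compsSuc m

Fi : ℕ → QSym
Fi i = map (λ γ → (1P , γ)) (comps i)

F1i : ℕ → QSym
F1i i = (1P , replicate i 1) ∷ []

-- The operators.  The sums over i ≥ 0 are infinite formally, but on
-- H_w all terms with i > |w| vanish (F_i^⊥ and F_{1^i}^⊥ lower degree by i),
-- so they are truncated at i = |w|.

Bw : ℤ → Word → NSym
Bw m w = sumN (map (λ i → (-1P ^P i) ·N (H (m ℤ.+ + i) *N perp (F1i i) (basis w)))
                   (upTo (suc (sum w))))

B : ℤ → NSym → NSym
B m = ext (Bw m)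

Btw : ℤ → Word → NSym
Btw m w = sumN (map (λ i → (qP ^P i) ·N B (m ℤ.+ + i) (perp (Fi i) (basis w)))
                    (upTo (suc (sum w))))

Bt : ℤ → NSym → NSym
Bt m = ext (Btw m)

Q'ℤ : List ℤ → NSym
Q'ℤ [] = basis []
Q'ℤ (a ∷ as) = Bt a (Q'ℤ as)

Q' : Word → NSym
Q' α = Q'ℤ (map +_ α)

part : Word → ℕ → ℕ
part [] j = 0
part (x ∷ xs) zero = x
part (x ∷ xs) (suc j) = part xs j

_⊂[_]_ : Word → ℕ → Word → Set
α ⊂[ s ] β = (sum β ≡ sum α ℕ.+ s)
           × (∀ j → j < length α → part α j ≤ part β j)
           × (length β ≤ suc (length α))

nrows : Word → Word → ℕ
nrows α β = length (filter (λ j → part α j <? part β j) (upTo (length α)))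

1-qP : Poly
1-qP = 1ℤ ∷ -1ℤ ∷ []

{-# OPTIONS --safe #-}
-- Pairing with linear functionals ψ on NSym turns every operator into its transpose, acting on
-- functions of words. The coproduct rules for F_{1^i}^⊥ and F_i^⊥ on f H_{s+1} give
--   B_m(f H_{s+1}) = B_m(f) H_{s+1} − B_{m+1}(f) H_s   and, from it,
--   B̃_m(f H_{s+1}) + B̃_{m+1}(f) H_s = B̃_m(f) H_{s+1} + q B̃_{m+1}(f H_s).
-- Unrolling the latter in s yields B̃_m(f) H_s = B̃_m(f H_s) + (1−q) Σ_{k≥1} B̃_{m+k}(f H_{s−k}),
-- and induction on α turns k into the number of boxes added to the first row.
module Submission where

open import Defs
open import Algebra.Bundles using (CommutativeMonoid)
open import Algebra.Construct.Pointwise using (isCommutativeMonoid)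
open import Algebra.Module.Bundles using (LeftModule)
open import Data.Bool using (true; false)
open import Data.Empty using (⊥-elim)
open import Data.Integer using (ℤ; +_; -[1+_]; 0ℤ; 1ℤ; -1ℤ)
import Data.Integer as ℤ
import Data.Integer.Properties as ℤ
open import Data.List using (List; []; _∷_; _++_; map; concatMap; upTo; applyUpTo; replicate; length; filter)
open import Data.List.Membership.Propositional using (_∈_)
open import Data.List.Membership.Propositional.Properties using (∈-map⁺; ∈-map⁻; ∈-++⁺ˡ; ∈-++⁺ʳ; ∈-++⁻)
open import Data.List.Membership.Propositional.Properties.WithK using (unique∧set⇒bag)
open import Data.List.Properties using (≡-dec; ++-identityʳ; filter-accept; filter-reject; ∷-injectiveˡ; ∷-injectiveʳ)
open import Data.List.Relation.Binary.BagAndSetEquality using (∼bag⇒↭)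
open import Data.List.Relation.Binary.Permutation.Propositional as ↭ using (_↭_)
open import Data.List.Relation.Unary.All as All using (All; []; _∷_)
import Data.List.Relation.Unary.All.Properties as All
open import Data.List.Relation.Unary.AllPairs using ([]; _∷_)
open import Data.List.Relation.Unary.Any using (here)
open import Data.List.Relation.Unary.Unique.Propositional using (Unique)
open import Data.List.Relation.Unary.Unique.Propositional.Properties using (map⁺; ++⁺)
open import Data.Nat using (ℕ; zero; suc; _+_; _∸_; _≤_; _<_; z≤n; s≤s; _<?_; _<ᵇ_)
open import Data.Nat.ListAction using (sum)
import Data.Nat.Properties as ℕ
open import Data.Nat.Solver using (module +-*-Solver)
open import Data.Product using (_×_; _,_; proj₁; ∃; ∃₂)
open import Data.Sum using (inj₁; inj₂)
open import Function using (_∘_; id; flip)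
open import Function.Bundles using (_⇔_; mk⇔; Equivalence)
open import Level using (0ℓ)
open import Relation.Binary.PropositionalEquality as ≡ using (_≡_; _≢_; refl; cong; cong₂)
open import Relation.Nullary using (¬_; yes; no)

open +-*-Solver using (solve; _:+_; _:=_)

-- The obstacle is that the truncation bounds in `Bw` and `Btw` depend on the word, so an operator
-- applied to w and to w followed by a letter s sums over different ranges. Once the sum over i is
-- exchanged with the coproduct, a left factor H_u meets at most one index, i = |u|, and the bound
-- disappears. The functional ψ stays arbitrary because the induction on α uses its hypothesis at
-- the transpose of B̃_b applied to ψ, which in general is not a coordinate functional; ψ becomes
-- coefficient extraction only at the very end. The constant 1-q arises as follows. In the
-- unrolling, B̃_{a+1}(f H_{s-1}) occurs with coefficient 1 inside B̃_{a+1}(f) H_{s-1} and once more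
-- with coefficient -q. All later terms are inherited with the coefficient 1-q they already have, so
-- a row collects a single factor however many boxes it gains. Boxes not placed in rows of α form a
-- new last row, which comes from multiplying 1 by H_s and so carries no factor.

Positive : Word → Set
Positive = All (0 <_)

-- Enumeration of the compositions obtained from α by adding s boxes.

longer : (ℕ → List Word) → ℕ → ℕ → List Word
longer g b zero    = []
longer g b (suc s) = map (suc b ∷_) (g s) ++ longer g (suc b) s

-- Follows the row-by-row recursion of `Q'`: the first row stays or grows, and the remaining boxes
-- go below. What is left at the end becomes one new row, which `cons0` omits when it would be
-- empty.
pieri : Word → ℕ → List Word
pieri []      s = cons0 s [] ∷ []
pieri (a ∷ α) s = map (a ∷_) (pieri α s) ++ longer (pieri α) a s

∈-longer⁻ : ∀ g b s {β} → β ∈ longer g b s →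
            ∃ λ k → ∃₂ λ t γ → s ≡ suc k + t × β ≡ (suc k + b) ∷ γ × γ ∈ g t
∈-longer⁻ g b (suc s) β∈ with ∈-++⁻ (map (suc b ∷_) (g s)) β∈
... | inj₁ β∈map = let γ , γ∈ , eq = ∈-map⁻ (suc b ∷_) β∈map in 0 , s , γ , refl , eq , γ∈
... | inj₂ β∈longer with ∈-longer⁻ g (suc b) s β∈longer
...   | k , t , γ , refl , refl , γ∈ = suc k , t , γ , refl , cong (_∷ γ) (cong suc (ℕ.+-suc k b)) , γ∈

∈-longer⁺ : ∀ g b k t {γ} → γ ∈ g t → ((suc k + b) ∷ γ) ∈ longer g b (suc k + t)
∈-longer⁺ g b zero    t γ∈ = ∈-++⁺ˡ (∈-map⁺ (suc b ∷_) γ∈)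
∈-longer⁺ g b (suc k) t {γ} γ∈ = ∈-++⁺ʳ (map (suc b ∷_) (g (suc k + t)))
  (≡.subst (λ n → (suc n ∷ γ) ∈ longer g (suc b) (suc k + t)) (ℕ.+-suc k b) (∈-longer⁺ g (suc b) k t γ∈))

∈-pieri-∷⁻ : ∀ a α s {β} → β ∈ pieri (a ∷ α) s →
             ∃ λ k → ∃₂ λ t γ → s ≡ k + t × β ≡ (k + a) ∷ γ × γ ∈ pieri α t
∈-pieri-∷⁻ a α s β∈ with ∈-++⁻ (map (a ∷_) (pieri α s)) β∈
... | inj₁ β∈map = let γ , γ∈ , eq = ∈-map⁻ (a ∷_) β∈map in 0 , s , γ , refl , eq , γ∈
... | inj₂ β∈longer = let k , rest = ∈-longer⁻ (pieri α) a s β∈longer in suc k , rest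

∈-pieri-∷⁺ : ∀ a α k t {γ} → γ ∈ pieri α t → ((k + a) ∷ γ) ∈ pieri (a ∷ α) (k + t)
∈-pieri-∷⁺ a α zero    t γ∈ = ∈-++⁺ˡ (∈-map⁺ (a ∷_) γ∈)
∈-pieri-∷⁺ a α (suc k) t γ∈ = ∈-++⁺ʳ (map (a ∷_) (pieri α (suc k + t))) (∈-longer⁺ (pieri α) a k t γ∈)

pieri-sound : ∀ {α} s {β} → Positive α → β ∈ pieri α s → Positive β × α ⊂[ s ] β
pieri-sound zero    []  (here refl) = [] , refl , (λ _ ()) , z≤n
pieri-sound (suc s) []  (here refl) = s≤s z≤n ∷ [] , ℕ.+-identityʳ (suc s) , (λ _ ()) , s≤s z≤n
pieri-sound {a ∷ α} s (a>0 ∷ α>0) β∈ with ∈-pieri-∷⁻ a α s β∈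
... | k , t , γ , refl , refl , γ∈ with pieri-sound t α>0 γ∈
...   | γ>0 , sum-γ , α≤γ , len-γ = (ℕ.≤-trans a>0 (ℕ.m≤n+m a k) ∷ γ>0) , sum-eq , parts , s≤s len-γ
  where
  open ≡.≡-Reasoning
  sum-eq : k + a + sum γ ≡ a + sum α + (k + t)
  sum-eq = begin
    k + a + sum γ         ≡⟨ cong (λ n → k + a + n) sum-γ ⟩
    k + a + (sum α + t)   ≡⟨ solve 4 (λ k a x t → k :+ a :+ (x :+ t) := a :+ x :+ (k :+ t)) refl k a (sum α) t ⟩
    a + sum α + (k + t)   ∎
  parts : ∀ j → j < suc (length α) → part (a ∷ α) j ≤ part ((k + a) ∷ γ) j
  parts zero    _         = ℕ.m≤n+m a k
  parts (suc j) (s≤s j<) = α≤γ j j<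

-- Guarantees that `sum β ∸ sum α`, the number of boxes added below the first row, is a true
-- difference.
part-≤⇒sum-≤ : ∀ α β → (∀ j → j < length α → part α j ≤ part β j) → sum α ≤ sum β
part-≤⇒sum-≤ []      β       _ = z≤n
part-≤⇒sum-≤ (a ∷ α) []      h = ℕ.+-mono-≤ (h 0 (s≤s z≤n)) (part-≤⇒sum-≤ α [] (λ j j< → h (suc j) (s≤s j<)))
part-≤⇒sum-≤ (a ∷ α) (b ∷ β) h = ℕ.+-mono-≤ (h 0 (s≤s z≤n)) (part-≤⇒sum-≤ α β (λ j j< → h (suc j) (s≤s j<)))

pieri-complete : ∀ {α} s {β} → Positive α → Positive β → α ⊂[ s ] β → β ∈ pieri α s
pieri-complete s []          []               (refl , _ , _)        = here refl
pieri-complete s []          (_∷_ {suc b} _ []) (sum-β , _ , _)     =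
  here (cong (λ n → cons0 n []) (≡.trans (≡.sym (ℕ.+-identityʳ (suc b))) sum-β))
pieri-complete s []          (_ ∷ _ ∷ _)      (_ , _ , s≤s ())
pieri-complete s (s≤s _ ∷ _) []               (_ , h , _) with () ← h 0 (s≤s z≤n)
pieri-complete {a ∷ α} s {b ∷ β} (_ ∷ α>0) (_ ∷ β>0) (sum-β , h , s≤s len-β) =
  ≡.subst₂ (λ n r → (n ∷ β) ∈ pieri (a ∷ α) r) (ℕ.m∸n+n≡m a≤b) (≡.sym s≡)
    (∈-pieri-∷⁺ a α k t (pieri-complete t α>0 β>0 (≡.sym (ℕ.m+[n∸m]≡n α≤β) , (λ j j< → h (suc j) (s≤s j<)) , len-β)))
  where
  a≤b = h 0 (s≤s z≤n)
  α≤β = part-≤⇒sum-≤ α β (λ j j< → h (suc j) (s≤s j<))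
  k = b ∸ a
  t = sum β ∸ sum α
  open ≡.≡-Reasoning
  s≡ : s ≡ k + t
  s≡ = ℕ.+-cancelˡ-≡ (a + sum α) s (k + t) (begin
    a + sum α + s               ≡⟨ sum-β ⟨
    b + sum β                   ≡⟨ cong₂ _+_ (ℕ.m∸n+n≡m a≤b) (ℕ.m+[n∸m]≡n α≤β) ⟨
    k + a + (sum α + t)         ≡⟨ solve 4 (λ k a x t → k :+ a :+ (x :+ t) := a :+ x :+ (k :+ t)) refl k a (sum α) t ⟩
    a + sum α + (k + t)         ∎)

-- First rows separate the pieces: everything produced by the recursive call has a head larger than
-- `suc b`.
longer-unique : ∀ g b s → (∀ t → Unique (g t)) → Unique (longer g b s)
longer-unique g b zero    u = []
longer-unique g b (suc s) u = ++⁺ (map⁺ ∷-injectiveʳ (u s)) (longer-unique g (suc b) s u) disjoint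
  where
  disjoint : ∀ {β} → ¬ (β ∈ map (suc b ∷_) (g s) × β ∈ longer g (suc b) s)
  disjoint (β∈map , β∈longer) with ∈-map⁻ (suc b ∷_) β∈map | ∈-longer⁻ g (suc b) s β∈longer
  ... | _ , _ , refl | k , _ , _ , _ , eq , _ = ℕ.m≢1+n+m (suc b) (∷-injectiveˡ eq)

pieri-unique : ∀ α s → Unique (pieri α s)
pieri-unique []      s = [] ∷ []
pieri-unique (a ∷ α) s = ++⁺ (map⁺ ∷-injectiveʳ (pieri-unique α s)) (longer-unique (pieri α) a s (pieri-unique α)) disjoint
  where
  disjoint : ∀ {β} → ¬ (β ∈ map (a ∷_) (pieri α s) × β ∈ longer (pieri α) a s)
  disjoint (β∈map , β∈longer) with ∈-map⁻ (a ∷_) β∈map | ∈-longer⁻ (pieri α) a s β∈longer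
  ... | _ , _ , refl | k , _ , _ , _ , eq , _ = ℕ.m≢1+n+m a (∷-injectiveˡ eq)

-- At a successor index `part` no longer sees the first row, so both filters test the same Boolean.
-- Unfolding `upTo` keeps shifting the index function, which is why `h` is arbitrary.
length-filter-applyUpTo : ∀ a α b β (h : ℕ → ℕ) n →
  length (filter (λ j → part (a ∷ α) j <? part (b ∷ β) j) (applyUpTo (suc ∘ h) n)) ≡
  length (filter (λ j → part α j <? part β j) (applyUpTo h n))
length-filter-applyUpTo a α b β h zero = refl
length-filter-applyUpTo a α b β h (suc n) with part α (h 0) <ᵇ part β (h 0)
... | true  = cong suc (length-filter-applyUpTo a α b β (h ∘ suc) n)
... | false = length-filter-applyUpTo a α b β (h ∘ suc) n

nrows-∷-< : ∀ {a b} → a < b → ∀ α β → nrows (a ∷ α) (b ∷ β) ≡ suc (nrows α β)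
nrows-∷-< {a} {b} a<b α β = ≡.trans
  (cong length (filter-accept (λ j → part (a ∷ α) j <? part (b ∷ β) j) {0} {applyUpTo suc (length α)} a<b))
  (cong suc (length-filter-applyUpTo a α b β id (length α)))

nrows-∷-≡ : ∀ a α β → nrows (a ∷ α) (a ∷ β) ≡ nrows α β
nrows-∷-≡ a α β = ≡.trans
  (cong length (filter-reject (λ j → part (a ∷ α) j <? part (a ∷ β) j) {0} {applyUpTo suc (length α)} (ℕ.<-irrefl refl)))
  (length-filter-applyUpTo a α a β id (length α))

-- A ℤ[q]-module presented as an abelian group with an endomorphism q.
record ℤ[q]-Module : Set₁ where
  field
    leftModule : LeftModule ℤ.+-*-ring 0ℓ 0ℓ
  open LeftModule leftModule public
    renaming ( Carrierᴹ to M; _≈ᴹ_ to _≈_; _+ᴹ_ to infixl 6 _⊕_; 0ᴹ to 𝟎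
             ; _*ₗ_ to infixr 7 _·_ )
  field
    q       : M → M
    q-cong  : ∀ {x y} → x ≈ y → q x ≈ q y
    q-⊕     : ∀ x y → q (x ⊕ y) ≈ q x ⊕ q y
    q-·     : ∀ a x → q (a · x) ≈ a · q x

-- Polynomials acting on a module.

module Functionals (𝓜 : ℤ[q]-Module) where
  open ℤ[q]-Module 𝓜
  open import Relation.Binary.Reasoning.Setoid ≈ᴹ-setoid
  open import Algebra.Properties.CommutativeSemigroup (CommutativeMonoid.commutativeSemigroup +ᴹ-commutativeMonoid) using (interchange; xy∙z≈xz∙y)
  open import Algebra.Properties.Group +ᴹ-group using (∙-cancelʳ)

  ⊕-congˡ : ∀ {x y z} → y ≈ z → x ⊕ y ≈ x ⊕ z
  ⊕-congˡ = +ᴹ-cong ≈ᴹ-refl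

  ⊕-congʳ : ∀ {x y z} → y ≈ z → y ⊕ x ≈ z ⊕ x
  ⊕-congʳ p = +ᴹ-cong p ≈ᴹ-refl

  q-𝟎 : q 𝟎 ≈ 𝟎
  q-𝟎 = begin
    q 𝟎         ≈⟨ q-cong (*ₗ-zeroˡ 𝟎) ⟨
    q (0ℤ · 𝟎)  ≈⟨ q-· 0ℤ 𝟎 ⟩
    0ℤ · q 𝟎    ≈⟨ *ₗ-zeroˡ (q 𝟎) ⟩
    𝟎           ∎

  infixr 7 _⊙_
  -- Horner evaluation of the coefficient list at the endomorphism `q`.
  _⊙_ : Poly → M → M
  []      ⊙ x = 𝟎
  (a ∷ p) ⊙ x = a · x ⊕ q (p ⊙ x)

  ⊙-cong : ∀ p {x y} → x ≈ y → p ⊙ x ≈ p ⊙ y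
  ⊙-cong []      e = ≈ᴹ-refl
  ⊙-cong (a ∷ p) e = +ᴹ-cong (*ₗ-congˡ e) (q-cong (⊙-cong p e))

  ⊙-distribˡ : ∀ p x y → p ⊙ (x ⊕ y) ≈ p ⊙ x ⊕ p ⊙ y
  ⊙-distribˡ []      x y = ≈ᴹ-sym (+ᴹ-identityˡ 𝟎)
  ⊙-distribˡ (a ∷ p) x y = begin
    a · (x ⊕ y) ⊕ q (p ⊙ (x ⊕ y))            ≈⟨ +ᴹ-cong (*ₗ-distribˡ a x y) (q-cong (⊙-distribˡ p x y)) ⟩
    (a · x ⊕ a · y) ⊕ q (p ⊙ x ⊕ p ⊙ y)      ≈⟨ ⊕-congˡ (q-⊕ _ _) ⟩
    (a · x ⊕ a · y) ⊕ (q (p ⊙ x) ⊕ q (p ⊙ y)) ≈⟨ interchange _ _ _ _ ⟩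
    (a ∷ p) ⊙ x ⊕ (a ∷ p) ⊙ y                ∎

  ⊙-zeroʳ : ∀ p → p ⊙ 𝟎 ≈ 𝟎
  ⊙-zeroʳ []      = ≈ᴹ-refl
  ⊙-zeroʳ (a ∷ p) = begin
    a · 𝟎 ⊕ q (p ⊙ 𝟎) ≈⟨ +ᴹ-cong (*ₗ-zeroʳ a) (≈ᴹ-trans (q-cong (⊙-zeroʳ p)) q-𝟎) ⟩
    𝟎 ⊕ 𝟎             ≈⟨ +ᴹ-identityˡ 𝟎 ⟩
    𝟎                 ∎

  +P-⊙ : ∀ p r x → (p +P r) ⊙ x ≈ p ⊙ x ⊕ r ⊙ x
  +P-⊙ []      r       x = ≈ᴹ-sym (+ᴹ-identityˡ _)
  +P-⊙ (a ∷ p) []      x = ≈ᴹ-sym (+ᴹ-identityʳ _)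
  +P-⊙ (a ∷ p) (b ∷ r) x = begin
    (a ℤ.+ b) · x ⊕ q ((p +P r) ⊙ x)         ≈⟨ +ᴹ-cong (*ₗ-distribʳ x a b) (q-cong (+P-⊙ p r x)) ⟩
    (a · x ⊕ b · x) ⊕ q (p ⊙ x ⊕ r ⊙ x)      ≈⟨ ⊕-congˡ (q-⊕ _ _) ⟩
    (a · x ⊕ b · x) ⊕ (q (p ⊙ x) ⊕ q (r ⊙ x)) ≈⟨ interchange _ _ _ _ ⟩
    (a ∷ p) ⊙ x ⊕ (b ∷ r) ⊙ x                ∎

  map-*-⊙ : ∀ a r x → map (a ℤ.*_) r ⊙ x ≈ a · (r ⊙ x)
  map-*-⊙ a []      x = ≈ᴹ-sym (*ₗ-zeroʳ a)
  map-*-⊙ a (b ∷ r) x = begin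
    (a ℤ.* b) · x ⊕ q (map (a ℤ.*_) r ⊙ x) ≈⟨ +ᴹ-cong (*ₗ-assoc a b x) (q-cong (map-*-⊙ a r x)) ⟩
    a · (b · x) ⊕ q (a · (r ⊙ x))          ≈⟨ ⊕-congˡ (q-· a _) ⟩
    a · (b · x) ⊕ a · q (r ⊙ x)            ≈⟨ *ₗ-distribˡ a _ _ ⟨
    a · (b · x ⊕ q (r ⊙ x))                ∎

  0∷-⊙ : ∀ p x → (0ℤ ∷ p) ⊙ x ≈ q (p ⊙ x)
  0∷-⊙ p x = ≈ᴹ-trans (⊕-congʳ (*ₗ-zeroˡ x)) (+ᴹ-identityˡ _)

  *P-⊙ : ∀ p r x → (p *P r) ⊙ x ≈ p ⊙ r ⊙ x
  *P-⊙ []      r x = ≈ᴹ-refl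
  *P-⊙ (a ∷ p) r x = begin
    (map (a ℤ.*_) r +P (0ℤ ∷ (p *P r))) ⊙ x         ≈⟨ +P-⊙ (map (a ℤ.*_) r) _ x ⟩
    map (a ℤ.*_) r ⊙ x ⊕ (0ℤ ∷ (p *P r)) ⊙ x        ≈⟨ +ᴹ-cong (map-*-⊙ a r x) (0∷-⊙ (p *P r) x) ⟩
    a · (r ⊙ x) ⊕ q ((p *P r) ⊙ x)                  ≈⟨ ⊕-congˡ (q-cong (*P-⊙ p r x)) ⟩
    a · (r ⊙ x) ⊕ q (p ⊙ r ⊙ x)                     ∎

  constant-⊙ : ∀ a x → (a ∷ []) ⊙ x ≈ a · x
  constant-⊙ a x = ≈ᴹ-trans (⊕-congˡ q-𝟎) (+ᴹ-identityʳ _)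

  1P-⊙ : ∀ x → 1P ⊙ x ≈ x
  1P-⊙ x = ≈ᴹ-trans (constant-⊙ 1ℤ x) (*ₗ-identityˡ x)

  -1P-⊙-inverse : ∀ x → -1P ⊙ x ⊕ x ≈ 𝟎
  -1P-⊙-inverse x = begin
    -1P ⊙ x ⊕ x         ≈⟨ +ᴹ-cong (constant-⊙ -1ℤ x) (≈ᴹ-sym (*ₗ-identityˡ x)) ⟩
    -1ℤ · x ⊕ 1ℤ · x    ≈⟨ *ₗ-distribʳ x -1ℤ 1ℤ ⟨
    0ℤ · x              ≈⟨ *ₗ-zeroˡ x ⟩
    𝟎                   ∎

  1-qP-⊙-complement : ∀ x → 1-qP ⊙ x ⊕ qP ⊙ x ≈ x
  1-qP-⊙-complement x = begin
    1-qP ⊙ x ⊕ qP ⊙ x   ≈⟨ +P-⊙ 1-qP qP x ⟨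
    1ℤ · x ⊕ q (0ℤ · x ⊕ q 𝟎) ≈⟨ +ᴹ-cong (*ₗ-identityˡ x) (q-cong (constant-⊙ 0ℤ x)) ⟩
    x ⊕ q (0ℤ · x)      ≈⟨ ⊕-congˡ (≈ᴹ-trans (q-cong (*ₗ-zeroˡ x)) q-𝟎) ⟩
    x ⊕ 𝟎               ≈⟨ +ᴹ-identityʳ x ⟩
    x                   ∎

  -- Finite sums in the module.

  module _ {A : Set} where

    Σ : List A → (A → M) → M
    Σ []       f = 𝟎
    Σ (x ∷ xs) f = f x ⊕ Σ xs f

    Σ-cong-All : ∀ {xs} {f g : A → M} → All (λ x → f x ≈ g x) xs → Σ xs f ≈ Σ xs g
    Σ-cong-All []       = ≈ᴹ-refl
    Σ-cong-All (p ∷ ps) = +ᴹ-cong p (Σ-cong-All ps)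

    Σ-cong : ∀ xs {f g : A → M} → (∀ x → f x ≈ g x) → Σ xs f ≈ Σ xs g
    Σ-cong xs e = Σ-cong-All (All.universal e xs)

    Σ-++ : ∀ xs ys (f : A → M) → Σ (xs ++ ys) f ≈ Σ xs f ⊕ Σ ys f
    Σ-++ []       ys f = ≈ᴹ-sym (+ᴹ-identityˡ _)
    Σ-++ (x ∷ xs) ys f = ≈ᴹ-trans (⊕-congˡ (Σ-++ xs ys f)) (≈ᴹ-sym (+ᴹ-assoc _ _ _))

    Σ-𝟎 : ∀ xs → Σ xs (λ (_ : A) → 𝟎) ≈ 𝟎
    Σ-𝟎 []       = ≈ᴹ-refl
    Σ-𝟎 (x ∷ xs) = ≈ᴹ-trans (+ᴹ-identityˡ _) (Σ-𝟎 xs)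

    Σ-⊕ : ∀ xs (f g : A → M) → Σ xs (λ x → f x ⊕ g x) ≈ Σ xs f ⊕ Σ xs g
    Σ-⊕ []       f g = ≈ᴹ-sym (+ᴹ-identityˡ _)
    Σ-⊕ (x ∷ xs) f g = ≈ᴹ-trans (⊕-congˡ (Σ-⊕ xs f g)) (interchange _ _ _ _)

    Σ-⊙ : ∀ p xs (f : A → M) → Σ xs (λ x → p ⊙ f x) ≈ p ⊙ Σ xs f
    Σ-⊙ p []       f = ≈ᴹ-sym (⊙-zeroʳ p)
    Σ-⊙ p (x ∷ xs) f = ≈ᴹ-trans (⊕-congˡ (Σ-⊙ p xs f)) (≈ᴹ-sym (⊙-distribˡ p _ _))

    Σ-↭ : ∀ {xs ys} (f : A → M) → xs ↭ ys → Σ xs f ≈ Σ ys f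
    Σ-↭ f ↭.refl         = ≈ᴹ-refl
    Σ-↭ f (↭.prep x p)   = ⊕-congˡ (Σ-↭ f p)
    Σ-↭ f (↭.swap x y p) = begin
      f x ⊕ (f y ⊕ _)  ≈⟨ +ᴹ-assoc _ _ _ ⟨
      (f x ⊕ f y) ⊕ _  ≈⟨ +ᴹ-cong (+ᴹ-comm _ _) (Σ-↭ f p) ⟩
      (f y ⊕ f x) ⊕ _  ≈⟨ +ᴹ-assoc _ _ _ ⟩
      f y ⊕ (f x ⊕ _)  ∎
    Σ-↭ f (↭.trans p r)  = ≈ᴹ-trans (Σ-↭ f p) (Σ-↭ f r)

  module _ {A B : Set} where

    Σ-map : ∀ (h : A → B) xs f → Σ (map h xs) f ≈ Σ xs (f ∘ h)
    Σ-map h []       f = ≈ᴹ-refl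
    Σ-map h (x ∷ xs) f = ⊕-congˡ (Σ-map h xs f)

    Σ-concatMap : ∀ (h : A → List B) xs f → Σ (concatMap h xs) f ≈ Σ xs (λ x → Σ (h x) f)
    Σ-concatMap h []       f = ≈ᴹ-refl
    Σ-concatMap h (x ∷ xs) f = ≈ᴹ-trans (Σ-++ (h x) _ f) (⊕-congˡ (Σ-concatMap h xs f))

    Σ-swap : ∀ (xs : List A) (ys : List B) (f : A → B → M) →
             Σ xs (λ x → Σ ys (f x)) ≈ Σ ys (λ y → Σ xs (flip f y))
    Σ-swap []       ys f = ≈ᴹ-sym (Σ-𝟎 ys)
    Σ-swap (x ∷ xs) ys f = ≈ᴹ-trans (⊕-congˡ (Σ-swap xs ys f)) (≈ᴹ-sym (Σ-⊕ ys _ _))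

  Σ< : ℕ → (ℕ → M) → M
  Σ< zero    f = 𝟎
  Σ< (suc n) f = f 0 ⊕ Σ< n (f ∘ suc)

  Σ<-cong : ∀ n {f g : ℕ → M} → (∀ i → f i ≈ g i) → Σ< n f ≈ Σ< n g
  Σ<-cong zero    e = ≈ᴹ-refl
  Σ<-cong (suc n) e = +ᴹ-cong (e 0) (Σ<-cong n (e ∘ suc))

  Σ<-𝟎 : ∀ n → Σ< n (λ _ → 𝟎) ≈ 𝟎
  Σ<-𝟎 zero    = ≈ᴹ-refl
  Σ<-𝟎 (suc n) = ≈ᴹ-trans (+ᴹ-identityˡ _) (Σ<-𝟎 n)

  Σ<-⊙ : ∀ p n f → Σ< n (λ i → p ⊙ f i) ≈ p ⊙ Σ< n f
  Σ<-⊙ p zero    f = ≈ᴹ-sym (⊙-zeroʳ p)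
  Σ<-⊙ p (suc n) f = ≈ᴹ-trans (⊕-congˡ (Σ<-⊙ p n (f ∘ suc))) (≈ᴹ-sym (⊙-distribˡ p _ _))

  Σ-applyUpTo : ∀ (h : ℕ → ℕ) n f → Σ (applyUpTo h n) f ≡ Σ< n (f ∘ h)
  Σ-applyUpTo h zero    f = refl
  Σ-applyUpTo h (suc n) f = cong (f (h 0) ⊕_) (Σ-applyUpTo (h ∘ suc) n f)

  Σ-upTo : ∀ n f → Σ (upTo n) f ≈ Σ< n f
  Σ-upTo n f = ≈ᴹ-reflexive (Σ-applyUpTo id n f)

  -- Linear functionals on NSym and the transposes of products and perp operators.

  ⟦_⟧ : (Word → M) → NSym → M
  ⟦ ψ ⟧ f = Σ f (λ (c , w) → c ⊙ ψ w)

  ⟦⟧-cong : ∀ {ψ ψ′} f → (∀ w → ψ w ≈ ψ′ w) → ⟦ ψ ⟧ f ≈ ⟦ ψ′ ⟧ f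
  ⟦⟧-cong f e = Σ-cong f (λ (c , w) → ⊙-cong c (e w))

  ⟦⟧-⊕ : ∀ ψ ψ′ f → ⟦ (λ w → ψ w ⊕ ψ′ w) ⟧ f ≈ ⟦ ψ ⟧ f ⊕ ⟦ ψ′ ⟧ f
  ⟦⟧-⊕ ψ ψ′ f = ≈ᴹ-trans (Σ-cong f (λ (c , w) → ⊙-distribˡ c _ _)) (Σ-⊕ f _ _)

  ⟦⟧-· : ∀ ψ c f → ⟦ ψ ⟧ (c ·N f) ≈ c ⊙ ⟦ ψ ⟧ f
  ⟦⟧-· ψ c []            = ≈ᴹ-sym (⊙-zeroʳ c)
  ⟦⟧-· ψ c ((d , w) ∷ f) = ≈ᴹ-trans (+ᴹ-cong (*P-⊙ c d _) (⟦⟧-· ψ c f)) (≈ᴹ-sym (⊙-distribˡ c _ _))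

  ⟦⟧-basis : ∀ ψ w → ⟦ ψ ⟧ (basis w) ≈ ψ w
  ⟦⟧-basis ψ w = ≈ᴹ-trans (+ᴹ-identityʳ _) (1P-⊙ _)

  ⟦⟧-sumN : ∀ {A : Set} ψ (F : A → NSym) xs → ⟦ ψ ⟧ (sumN (map F xs)) ≈ Σ xs (λ x → ⟦ ψ ⟧ (F x))
  ⟦⟧-sumN ψ F []       = ≈ᴹ-refl
  ⟦⟧-sumN ψ F (x ∷ xs) = ≈ᴹ-trans (Σ-++ (F x) _ _) (⊕-congˡ (⟦⟧-sumN ψ F xs))

  ⟦⟧-ext : ∀ ψ φ f → ⟦ ψ ⟧ (ext φ f) ≈ ⟦ (λ w → ⟦ ψ ⟧ (φ w)) ⟧ f
  ⟦⟧-ext ψ φ f = ≈ᴹ-trans (Σ-concatMap _ f _) (Σ-cong f (λ (c , w) → ⟦⟧-· ψ c (φ w)))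

  infixl 6 _▹_
  -- Right multiplication by H_s on the level of words; H_0 = 1 adds no letter.
  _▹_ : Word → ℕ → Word
  w ▹ s = w ++ cons0 s []

  H-basis : ∀ s → H (+ s) ≡ basis (cons0 s [])
  H-basis zero    = refl
  H-basis (suc s) = refl

  Σ-*P-⊙ : ∀ {A : Set} c xs (d : A → Poly) (f : A → M) →
           Σ xs (λ x → (c *P d x) ⊙ f x) ≈ c ⊙ Σ xs (λ x → d x ⊙ f x)
  Σ-*P-⊙ c xs d f = ≈ᴹ-trans (Σ-cong xs (λ x → *P-⊙ c (d x) (f x))) (Σ-⊙ c xs _)

  ⟦⟧-*N : ∀ ψ f g → ⟦ ψ ⟧ (f *N g) ≈ ⟦ (λ u → ⟦ (λ v → ψ (u ++ v)) ⟧ g) ⟧ f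
  ⟦⟧-*N ψ f g = ≈ᴹ-trans (Σ-concatMap _ f _) (Σ-cong f λ (c , u) →
    ≈ᴹ-trans (Σ-map _ g _) (Σ-*P-⊙ c g proj₁ _))

  ⟦⟧-*H : ∀ ψ f s → ⟦ ψ ⟧ (f *N H (+ s)) ≈ ⟦ (λ w → ψ (w ▹ s)) ⟧ f
  ⟦⟧-*H ψ f s rewrite H-basis s =
    ≈ᴹ-trans (⟦⟧-*N ψ f _) (⟦⟧-cong f (λ w → ⟦⟧-basis (λ v → ψ (w ++ v)) _))

  -- ⟦ H[ k ] ψ ⟧ is the functional f ↦ ⟦ ψ ⟧ (H_k f).
  H[_] : ℤ → (Word → M) → Word → M
  H[ + k ]      ψ w = ψ (cons0 k w)
  H[ -[1+ k ] ] ψ w = 𝟎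

  ⟦⟧-basis*N : ∀ ψ u f → ⟦ ψ ⟧ (basis u *N f) ≈ ⟦ (λ w → ψ (u ++ w)) ⟧ f
  ⟦⟧-basis*N ψ u f = ≈ᴹ-trans (⟦⟧-*N ψ (basis u) f) (⟦⟧-basis (λ u → ⟦ (λ v → ψ (u ++ v)) ⟧ f) u)

  ⟦⟧-H* : ∀ ψ k f → ⟦ ψ ⟧ (H k *N f) ≈ ⟦ H[ k ] ψ ⟧ f
  ⟦⟧-H* ψ (+ zero)  f = ⟦⟧-basis*N ψ [] f
  ⟦⟧-H* ψ (+ suc k) f = ⟦⟧-basis*N ψ (suc k ∷ []) f
  ⟦⟧-H* ψ -[1+ k ]  f = ≈ᴹ-sym (≈ᴹ-trans (Σ-cong f (λ (c , w) → ⊙-zeroʳ c)) (Σ-𝟎 f))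

  ⟦⟧-perp : ∀ ψ F f → ⟦ ψ ⟧ (perp F f) ≈ ⟦ (λ w → Σ (Δw w) (λ (u , v) → pairW u F ⊙ ψ v)) ⟧ f
  ⟦⟧-perp ψ F f = ≈ᴹ-trans (Σ-concatMap _ f _) (Σ-cong f λ (c , w) →
    ≈ᴹ-trans (Σ-map _ (Δw w) _) (Σ-*P-⊙ c (Δw w) (λ (u , v) → pairW u F) _))

  ⟦⟧-perp-basis : ∀ ψ F w → ⟦ ψ ⟧ (perp F (basis w)) ≈ Σ (Δw w) (λ (u , v) → pairW u F ⊙ ψ v)
  ⟦⟧-perp-basis ψ F w =
    ≈ᴹ-trans (⟦⟧-perp ψ F (basis w)) (⟦⟧-basis (λ w → Σ (Δw w) (λ (u , v) → pairW u F ⊙ ψ v)) w)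

  -- Pairing H_u with the fundamental quasisymmetric functions.

  ==W-cong : ∀ {u v u′ v′} c → (u ≡ v → u′ ≡ v′) → (u′ ≡ v′ → u ≡ v) → (u ==W v) c ≡ (u′ ==W v′) c
  ==W-cong {u} {v} {u′} {v′} c to from with ≡-dec ℕ._≟_ u v | ≡-dec ℕ._≟_ u′ v′
  ... | yes p | yes _ = refl
  ... | yes p | no ¬r = ⊥-elim (¬r (to p))
  ... | no ¬p | yes r = ⊥-elim (¬p (from r))
  ... | no _  | no _  = refl

  ==W-≢ : ∀ {u v} c → u ≢ v → (u ==W v) c ≡ 0P
  ==W-≢ {u} {v} c u≢v with ≡-dec ℕ._≟_ u v
  ... | yes p = ⊥-elim (u≢v p)
  ... | no _  = refl

  δ : Word → Word → M → M
  δ u v x = (u ==W v) 1P ⊙ x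

  δ-∷ : ∀ a u v x → δ (a ∷ u) (a ∷ v) x ≈ δ u v x
  δ-∷ a u v x = ≈ᴹ-reflexive (cong (_⊙ x) (==W-cong {a ∷ u} {a ∷ v} 1P ∷-injectiveʳ (cong (a ∷_))))

  δ-suc : ∀ a b u v x → δ (suc a ∷ u) (suc b ∷ v) x ≈ δ (a ∷ u) (b ∷ v) x
  δ-suc a b u v x = ≈ᴹ-reflexive (cong (_⊙ x) (==W-cong {suc a ∷ u} {suc b ∷ v} {a ∷ u} {b ∷ v} 1P
    (λ e → cong₂ _∷_ (ℕ.suc-injective (∷-injectiveˡ e)) (∷-injectiveʳ e))
    (λ e → cong₂ _∷_ (cong suc (∷-injectiveˡ e)) (∷-injectiveʳ e))))

  δ-≢ : ∀ u v x → u ≢ v → δ u v x ≈ 𝟎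
  δ-≢ u v x u≢v = ≈ᴹ-reflexive (cong (_⊙ x) (==W-≢ 1P u≢v))

  -- Defined by recursion so that a common successor cancels by computation, in step with the
  -- induction on m in `Σ-compsSuc`.
  δℕ : ℕ → ℕ → M → M
  δℕ zero    zero    x = x
  δℕ zero    (suc _) x = 𝟎
  δℕ (suc _) zero    x = 𝟎
  δℕ (suc m) (suc n) x = δℕ m n x

  δℕ-refl : ∀ n x → δℕ n n x ≡ x
  δℕ-refl zero    x = refl
  δℕ-refl (suc n) x = δℕ-refl n x

  δℕ-≢ : ∀ {m n} x → n ≢ m → δℕ m n x ≡ 𝟎
  δℕ-≢ {zero}  {zero}  x ne = ⊥-elim (ne refl)
  δℕ-≢ {zero}  {suc n} x ne = refl
  δℕ-≢ {suc m} {zero}  x ne = refl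
  δℕ-≢ {suc m} {suc n} x ne = δℕ-≢ x (ne ∘ cong suc)

  pairW-⊙ : ∀ u F x → pairW u F ⊙ x ≈ Σ F (λ (d , v) → (u ==W v) d ⊙ x)
  pairW-⊙ u []            x = ≈ᴹ-refl
  pairW-⊙ u ((d , v) ∷ F) x = ≈ᴹ-trans (+P-⊙ ((u ==W v) d) _ x) (⊕-congˡ (pairW-⊙ u F x))

  pairW-F1i : ∀ u i x → pairW u (F1i i) ⊙ x ≈ δ u (replicate i 1) x
  pairW-F1i u i x = ≈ᴹ-trans (pairW-⊙ u (F1i i) x) (+ᴹ-identityʳ _)

  compsSuc-head : ∀ m → All (λ γ → ∃₂ λ b γ′ → γ ≡ suc b ∷ γ′) (compsSuc m)
  compsSuc-head zero    = (0 , [] , refl) ∷ []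
  compsSuc-head (suc m) = All.++⁺
    (All.map⁺ (All.map (λ { (b , γ′ , refl) → suc b , γ′ , refl }) (compsSuc-head m)))
    (All.map⁺ (All.universal (λ γ → 0 , γ , refl) (compsSuc m)))

  Σ-vanish : ∀ {A : Set} {xs} {f : A → M} → All (λ x → f x ≈ 𝟎) xs → Σ xs f ≈ 𝟎
  Σ-vanish {xs = xs} z = ≈ᴹ-trans (Σ-cong-All z) (Σ-𝟎 xs)

  -- Every composition of m+1 is listed exactly once: first part at least 2 through `bumpHead`,
  -- first part 1 through `1 ∷_`. The head of `u` therefore decides which half can match, and the
  -- other half vanishes.
  Σ-compsSuc : ∀ m {u} x → Positive u → Σ (compsSuc m) (λ γ → δ u γ x) ≈ δℕ (sum u) (suc m) x
  Σ-compsSuc zero x []                                = +ᴹ-identityʳ 𝟎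
  Σ-compsSuc zero x (s≤s (z≤n {zero}) ∷ [])           = ≈ᴹ-trans (+ᴹ-identityʳ _) (1P-⊙ x)
  Σ-compsSuc zero {_ ∷ _ ∷ u} x (s≤s (z≤n {zero}) ∷ (s≤s (z≤n {b}) ∷ _)) =
    ≈ᴹ-trans (+ᴹ-identityʳ _) (δ-≢ (1 ∷ suc b ∷ u) (1 ∷ []) x (λ ()))
  Σ-compsSuc zero {_ ∷ u} x (s≤s (z≤n {suc a}) ∷ _) =
    ≈ᴹ-trans (+ᴹ-identityʳ _) (δ-≢ (suc (suc a) ∷ u) (1 ∷ []) x (λ ()))
  Σ-compsSuc (suc m) {u} x u>0 = begin
    Σ (compsSuc (suc m)) (λ γ → δ u γ x)
      ≈⟨ Σ-++ (map bumpHead (compsSuc m)) _ _ ⟩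
    Σ (map bumpHead (compsSuc m)) (λ γ → δ u γ x) ⊕ Σ (map (1 ∷_) (compsSuc m)) (λ γ → δ u γ x)
      ≈⟨ +ᴹ-cong (Σ-map bumpHead (compsSuc m) _) (Σ-map (1 ∷_) (compsSuc m) _) ⟩
    Σ (compsSuc m) (λ γ → δ u (bumpHead γ) x) ⊕ Σ (compsSuc m) (λ γ → δ u (1 ∷ γ) x)
      ≈⟨ split u>0 ⟩
    δℕ (sum u) (suc (suc m)) x ∎
    where
    split : ∀ {u} → Positive u →
            Σ (compsSuc m) (λ γ → δ u (bumpHead γ) x) ⊕ Σ (compsSuc m) (λ γ → δ u (1 ∷ γ) x)
            ≈ δℕ (sum u) (suc (suc m)) x
    split [] = ≈ᴹ-trans
      (+ᴹ-cong (Σ-vanish (All.map (λ { (b , γ′ , refl) → ≈ᴹ-refl }) (compsSuc-head m))) (Σ-𝟎 (compsSuc m)))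
      (+ᴹ-identityʳ 𝟎)
    split {u = _ ∷ u′} (s≤s (z≤n {zero}) ∷ u′>0) = ≈ᴹ-trans
      (+ᴹ-cong (Σ-vanish (All.map (λ { (b , γ′ , refl) → δ-≢ (1 ∷ u′) (suc (suc b) ∷ γ′) x (λ ()) }) (compsSuc-head m)))
               (≈ᴹ-trans (Σ-cong (compsSuc m) (λ γ → δ-∷ 1 u′ γ x)) (Σ-compsSuc m x u′>0)))
      (+ᴹ-identityˡ _)
    split {u = _ ∷ u′} (s≤s (z≤n {suc a}) ∷ u′>0) = ≈ᴹ-trans
      (+ᴹ-cong (≈ᴹ-trans (Σ-cong-All (All.map (λ { (b , γ′ , refl) → δ-suc (suc a) (suc b) u′ γ′ x }) (compsSuc-head m)))
                         (Σ-compsSuc m {suc a ∷ u′} x (s≤s z≤n ∷ u′>0)))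
               (Σ-vanish (All.universal (λ γ → δ-≢ (suc (suc a) ∷ u′) (1 ∷ γ) x (λ ())) (compsSuc m))))
      (+ᴹ-identityʳ _)

  -- F_i contains every M_γ of degree i once, so only the degree of u matters.
  pairW-Fi : ∀ {u} i x → Positive u → pairW u (Fi i) ⊙ x ≈ δℕ (sum u) i x
  pairW-Fi {u} i x u>0 = ≈ᴹ-trans (pairW-⊙ u (Fi i) x) (≈ᴹ-trans (Σ-map _ (comps i) _) (count i u>0))
    where
    count : ∀ i {u} → Positive u → Σ (comps i) (λ γ → δ u γ x) ≈ δℕ (sum u) i x
    count zero    []            = ≈ᴹ-trans (+ᴹ-identityʳ _) (1P-⊙ x)
    count zero    (s≤s z≤n ∷ _) = +ᴹ-identityʳ _
    count (suc m) u>0           = Σ-compsSuc m x u>0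

  Σ<-single : ∀ {N n} (f : ℕ → M) → n < N → (∀ i → i ≢ n → f i ≈ 𝟎) → Σ< N f ≈ f n
  Σ<-single {suc N} {zero}  f _         z = ≈ᴹ-trans
    (⊕-congˡ (≈ᴹ-trans (Σ<-cong N (λ i → z (suc i) (λ ()))) (Σ<-𝟎 N))) (+ᴹ-identityʳ _)
  Σ<-single {suc N} {suc n} f (s≤s n<N) z = ≈ᴹ-trans
    (+ᴹ-cong (z 0 (λ ())) (Σ<-single (f ∘ suc) n<N (λ i i≢n → z (suc i) (i≢n ∘ ℕ.suc-injective)))) (+ᴹ-identityˡ _)

  ⊙-vanish : ∀ p {x} → x ≈ 𝟎 → p ⊙ x ≈ 𝟎
  ⊙-vanish p e = ≈ᴹ-trans (⊙-cong p e) (⊙-zeroʳ p)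

  sum-replicate-1 : ∀ i → sum (replicate i 1) ≡ i
  sum-replicate-1 zero    = refl
  sum-replicate-1 (suc i) = cong suc (sum-replicate-1 i)

  -- elementary u ξ and complete u ξ are the only surviving terms of the series
  -- Σ_i (-1)^i ⟨H_u , F_{1^i}⟩ ξ_i and Σ_i q^i ⟨H_u , F_i⟩ ξ_i.
  elementary complete : Word → (ℕ → M) → M
  elementary u ξ = (-1P ^P sum u) ⊙ δ u (replicate (sum u) 1) (ξ (sum u))
  complete   u ξ = (qP ^P sum u) ⊙ ξ (sum u)

  Σ<-F1i : ∀ {u N} ξ → sum u ≤ N → Σ< (suc N) (λ i → (-1P ^P i) ⊙ pairW u (F1i i) ⊙ ξ i) ≈ elementary u ξ
  Σ<-F1i {u} {N} ξ u≤N = ≈ᴹ-trans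
    (Σ<-cong (suc N) (λ i → ⊙-cong (-1P ^P i) (pairW-F1i u i (ξ i))))
    (Σ<-single (λ i → (-1P ^P i) ⊙ δ u (replicate i 1) (ξ i)) (s≤s u≤N) (λ i i≢ →
      ⊙-vanish (-1P ^P i) (δ-≢ u (replicate i 1) (ξ i)
      (λ { refl → i≢ (≡.sym (sum-replicate-1 i)) }))))

  Σ<-Fi : ∀ {u N} ξ → Positive u → sum u ≤ N →
          Σ< (suc N) (λ i → (qP ^P i) ⊙ pairW u (Fi i) ⊙ ξ i) ≈ complete u ξ
  Σ<-Fi {u} {N} ξ u>0 u≤N = begin
    Σ< (suc N) (λ i → (qP ^P i) ⊙ pairW u (Fi i) ⊙ ξ i)
      ≈⟨ Σ<-cong (suc N) (λ i → ⊙-cong (qP ^P i) (pairW-Fi i (ξ i) u>0)) ⟩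
    Σ< (suc N) (λ i → (qP ^P i) ⊙ δℕ (sum u) i (ξ i))
      ≈⟨ Σ<-single (λ i → (qP ^P i) ⊙ δℕ (sum u) i (ξ i)) (s≤s u≤N) (λ i i≢ → ⊙-vanish (qP ^P i) (≈ᴹ-reflexive (δℕ-≢ (ξ i) i≢))) ⟩
    (qP ^P sum u) ⊙ δℕ (sum u) (sum u) (ξ (sum u))
      ≈⟨ ⊙-cong (qP ^P sum u) (≈ᴹ-reflexive (δℕ-refl (sum u) _)) ⟩
    complete u ξ ∎

  Σ<-cong-< : ∀ n {f g : ℕ → M} → (∀ i → i < n → f i ≈ g i) → Σ< n f ≈ Σ< n g
  Σ<-cong-< zero    e = ≈ᴹ-refl
  Σ<-cong-< (suc n) e = +ᴹ-cong (e 0 (s≤s z≤n)) (Σ<-cong-< n (λ i i<n → e (suc i) (s≤s i<n)))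

  -- Sums over the coproduct, and the operators as such sums.

  ΣΔ : (Word → Word → M) → Word → M
  ΣΔ κ w = Σ (Δw w) (λ (u , v) → κ u v)

  ΣΔ-∷ : ∀ κ a w → ΣΔ κ (a ∷ w) ≈ Σ< (suc a) (λ i → ΣΔ (λ u v → κ (cons0 i u) (cons0 (a ∸ i) v)) w)
  ΣΔ-∷ κ a w = ≈ᴹ-trans (Σ-++ (map _ (Δw w)) _ _) (+ᴹ-cong (Σ-map _ (Δw w) _) (≈ᴹ-trans
    (Σ-concatMap _ (applyUpTo suc a) _) (≈ᴹ-trans (≈ᴹ-reflexive (Σ-applyUpTo suc a _))
    (Σ<-cong a (λ i → Σ-map _ (Δw w) _)))))

  ΣΔ-cong : ∀ {κ κ′} w → (∀ u v → κ u v ≈ κ′ u v) → ΣΔ κ w ≈ ΣΔ κ′ w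
  ΣΔ-cong w e = Σ-cong (Δw w) (λ (u , v) → e u v)

  cons0-positive : ∀ i {u} → Positive u → Positive (cons0 i u)
  cons0-positive zero    u>0 = u>0
  cons0-positive (suc i) u>0 = s≤s z≤n ∷ u>0

  sum-cons0 : ∀ i u → sum (cons0 i u) ≡ i + sum u
  sum-cons0 zero    u = refl
  sum-cons0 (suc i) u = refl

  -- Left tensor factors have positive parts, since `cons0` drops zeros even when `w` contains them,
  -- and degree at most |w|. These are the two facts needed to collapse a truncated series.
  ΣΔ-cong-≤ : ∀ κ κ′ w → (∀ u v → Positive u → sum u ≤ sum w → κ u v ≈ κ′ u v) → ΣΔ κ w ≈ ΣΔ κ′ w
  ΣΔ-cong-≤ κ κ′ []      e = ⊕-congʳ (e [] [] [] z≤n)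
  ΣΔ-cong-≤ κ κ′ (a ∷ w) e = ≈ᴹ-trans (ΣΔ-∷ κ a w) (≈ᴹ-trans
    (Σ<-cong-< (suc a) (λ { i (s≤s i≤a) →
      ΣΔ-cong-≤ (λ u v → κ (cons0 i u) (cons0 (a ∸ i) v)) (λ u v → κ′ (cons0 i u) (cons0 (a ∸ i) v)) w
        (λ u v u>0 u≤w → e _ _ (cons0-positive i u>0)
          (ℕ.≤-trans (ℕ.≤-reflexive (sum-cons0 i u)) (ℕ.+-mono-≤ i≤a u≤w))) }))
    (≈ᴹ-sym (ΣΔ-∷ κ′ a w)))

  -- After exchanging the two sums, the inner one over i collapses by hypothesis, because |u| ≤ |w|
  -- keeps the only surviving index within the truncation. The right side mentions no bound, so it
  -- can be compared across words of different degree.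
  series : ∀ c (F : ℕ → QSym) (κ : Word → (ℕ → M) → M) →
           (∀ {u N} ξ → Positive u → sum u ≤ N →
             Σ< (suc N) (λ i → (c ^P i) ⊙ pairW u (F i) ⊙ ξ i) ≈ κ u ξ) →
           ∀ (χ : ℕ → Word → M) w → Σ (upTo (suc (sum w))) (λ i → (c ^P i) ⊙ ΣΔ (λ u v → pairW u (F i) ⊙ χ i v) w)
                   ≈ ΣΔ (λ u v → κ u (λ i → χ i v)) w
  series c F κ collapse χ w = begin
    Σ I (λ i → (c ^P i) ⊙ ΣΔ (λ u v → pairW u (F i) ⊙ χ i v) w)
      ≈⟨ Σ-cong I (λ i → Σ-⊙ (c ^P i) (Δw w) _) ⟨
    Σ I (λ i → ΣΔ (λ u v → (c ^P i) ⊙ pairW u (F i) ⊙ χ i v) w)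
      ≈⟨ Σ-swap I (Δw w) _ ⟩
    ΣΔ (λ u v → Σ I (λ i → (c ^P i) ⊙ pairW u (F i) ⊙ χ i v)) w
      ≈⟨ ΣΔ-cong-≤ _ _ w (λ u v u>0 u≤w → ≈ᴹ-trans (Σ-upTo (suc (sum w)) _) (collapse (λ i → χ i v) u>0 u≤w)) ⟩
    ΣΔ (λ u v → κ u (λ i → χ i v)) w ∎
    where I = upTo (suc (sum w))

  𝔹 𝕋 : (ℕ → Word → M) → Word → M
  𝔹 χ = ΣΔ (λ u v → elementary u (λ i → χ i v))
  𝕋 χ = ΣΔ (λ u v → complete u (λ i → χ i v))

  ⟦⟧-Bw : ∀ ψ m w → ⟦ ψ ⟧ (Bw m w) ≈ 𝔹 (λ i → H[ m ℤ.+ + i ] ψ) w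
  ⟦⟧-Bw ψ m w = begin
    ⟦ ψ ⟧ (Bw m w)
      ≈⟨ ⟦⟧-sumN ψ (λ i → (-1P ^P i) ·N (H (m ℤ.+ + i) *N perp (F1i i) (basis w))) I ⟩
    Σ I (λ i → ⟦ ψ ⟧ ((-1P ^P i) ·N (H (m ℤ.+ + i) *N perp (F1i i) (basis w))))
      ≈⟨ Σ-cong I (λ i → ≈ᴹ-trans (⟦⟧-· ψ (-1P ^P i) (H (m ℤ.+ + i) *N perp (F1i i) (basis w)))
           (⊙-cong (-1P ^P i) (≈ᴹ-trans (⟦⟧-H* ψ (m ℤ.+ + i) (perp (F1i i) (basis w)))
                                         (⟦⟧-perp-basis (H[ m ℤ.+ + i ] ψ) (F1i i) w)))) ⟩
    Σ I (λ i → (-1P ^P i) ⊙ ΣΔ (λ u v → pairW u (F1i i) ⊙ H[ m ℤ.+ + i ] ψ v) w)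
      ≈⟨ series -1P F1i elementary (λ {u} ξ _ → Σ<-F1i {u} ξ) (λ i → H[ m ℤ.+ + i ] ψ) w ⟩
    𝔹 (λ i → H[ m ℤ.+ + i ] ψ) w ∎
    where I = upTo (suc (sum w))

  -- The transposes of B_m and B̃_m.
  B* T* : ℤ → (Word → M) → Word → M
  B* m ψ w = ⟦ ψ ⟧ (Bw m w)
  T* m ψ w = ⟦ ψ ⟧ (Btw m w)

  ⟦⟧-Btw : ∀ ψ m w → T* m ψ w ≈ 𝕋 (λ i → B* (m ℤ.+ + i) ψ) w
  ⟦⟧-Btw ψ m w = begin
    ⟦ ψ ⟧ (Btw m w)
      ≈⟨ ⟦⟧-sumN ψ (λ i → (qP ^P i) ·N B (m ℤ.+ + i) (perp (Fi i) (basis w))) I ⟩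
    Σ I (λ i → ⟦ ψ ⟧ ((qP ^P i) ·N B (m ℤ.+ + i) (perp (Fi i) (basis w))))
      ≈⟨ Σ-cong I (λ i → ≈ᴹ-trans (⟦⟧-· ψ (qP ^P i) (B (m ℤ.+ + i) (perp (Fi i) (basis w))))
           (⊙-cong (qP ^P i) (≈ᴹ-trans (⟦⟧-ext ψ (Bw (m ℤ.+ + i)) (perp (Fi i) (basis w)))
                                        (⟦⟧-perp-basis (B* (m ℤ.+ + i) ψ) (Fi i) w)))) ⟩
    Σ I (λ i → (qP ^P i) ⊙ ΣΔ (λ u v → pairW u (Fi i) ⊙ B* (m ℤ.+ + i) ψ v) w)
      ≈⟨ series qP Fi complete Σ<-Fi (λ i → B* (m ℤ.+ + i) ψ) w ⟩
    𝕋 (λ i → B* (m ℤ.+ + i) ψ) w ∎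
    where I = upTo (suc (sum w))

  -- Coproduct rules for splitting off the first letter, then the last.

  elementary-1∷ : ∀ u ξ → elementary (1 ∷ u) ξ ≈ -1P ⊙ elementary u (ξ ∘ suc)
  elementary-1∷ u ξ = ≈ᴹ-trans (*P-⊙ -1P (-1P ^P sum u) _)
    (⊙-cong -1P (⊙-cong (-1P ^P sum u) (δ-∷ 1 u (replicate (sum u) 1) _)))

  elementary-2+∷ : ∀ i u ξ → elementary (suc (suc i) ∷ u) ξ ≈ 𝟎
  elementary-2+∷ i u ξ = ⊙-vanish (-1P ^P suc (suc (i + sum u)))
    (δ-≢ (suc (suc i) ∷ u) (replicate (suc (suc (i + sum u))) 1) (ξ (suc (suc (i + sum u)))) (λ ()))

  complete-suc∷ : ∀ i u ξ → complete (suc i ∷ u) ξ ≈ qP ⊙ complete (cons0 i u) (ξ ∘ suc)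
  complete-suc∷ i u ξ rewrite sum-cons0 i u = *P-⊙ qP (qP ^P (i + sum u)) _

  ΣΔ-⊙ : ∀ p κ w → ΣΔ (λ u v → p ⊙ κ u v) w ≈ p ⊙ ΣΔ κ w
  ΣΔ-⊙ p κ w = Σ-⊙ p (Δw w) _

  ΣΔ-0∷ : ∀ κ w → ΣΔ κ (0 ∷ w) ≈ ΣΔ κ w
  ΣΔ-0∷ κ w = ≈ᴹ-trans (ΣΔ-∷ κ 0 w) (+ᴹ-identityʳ _)

  -- Among the terms H_i ⊗ H_{a+1-i} of the first letter, only i = 0 and i = 1 can pair with a
  -- composition all of whose parts are 1.
  𝔹-suc∷ : ∀ χ a w → 𝔹 χ (suc a ∷ w) ≈
           𝔹 (λ i v → χ i (suc a ∷ v)) w ⊕ -1P ⊙ 𝔹 (λ i v → χ (suc i) (cons0 a v)) w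
  𝔹-suc∷ χ a w = ≈ᴹ-trans (ΣΔ-∷ _ (suc a) w) (⊕-congˡ (begin
    Σ< (suc a) (λ i → ΣΔ (λ u v → elementary (suc i ∷ u) (λ j → χ j (cons0 (a ∸ i) v))) w)
      ≈⟨ +ᴹ-cong (ΣΔ-cong w (λ u v → elementary-1∷ u (λ j → χ j (cons0 a v))))
                 (≈ᴹ-trans (Σ<-cong a (λ i → ≈ᴹ-trans (ΣΔ-cong w (λ u v → elementary-2+∷ i u (λ j → χ j (cons0 (a ∸ suc i) v)))) (Σ-𝟎 (Δw w)))) (Σ<-𝟎 a)) ⟩
    ΣΔ (λ u v → -1P ⊙ elementary u (λ i → χ (suc i) (cons0 a v))) w ⊕ 𝟎
      ≈⟨ +ᴹ-identityʳ _ ⟩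
    ΣΔ (λ u v → -1P ⊙ elementary u (λ i → χ (suc i) (cons0 a v))) w
      ≈⟨ ΣΔ-⊙ -1P _ w ⟩
    -1P ⊙ 𝔹 (λ i v → χ (suc i) (cons0 a v)) w ∎))

  𝕋-suc∷ : ∀ χ a w → 𝕋 χ (suc a ∷ w) ≈ 𝕋 (λ i v → χ i (suc a ∷ v)) w ⊕ qP ⊙ 𝕋 (χ ∘ suc) (a ∷ w)
  𝕋-suc∷ χ a w = ≈ᴹ-trans (ΣΔ-∷ _ (suc a) w) (⊕-congˡ (begin
    Σ< (suc a) (λ i → ΣΔ (λ u v → complete (suc i ∷ u) (λ j → χ j (cons0 (a ∸ i) v))) w)
      ≈⟨ Σ<-cong (suc a) (λ i → ≈ᴹ-trans (ΣΔ-cong w (λ u v → complete-suc∷ i u (λ j → χ j (cons0 (a ∸ i) v)))) (ΣΔ-⊙ qP _ w)) ⟩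
    Σ< (suc a) (λ i → qP ⊙ ΣΔ (λ u v → complete (cons0 i u) (λ j → χ (suc j) (cons0 (a ∸ i) v))) w)
      ≈⟨ Σ<-⊙ qP (suc a) (λ i → ΣΔ (λ u v → complete (cons0 i u) (λ j → χ (suc j) (cons0 (a ∸ i) v))) w) ⟩
    qP ⊙ Σ< (suc a) (λ i → ΣΔ (λ u v → complete (cons0 i u) (λ j → χ (suc j) (cons0 (a ∸ i) v))) w)
      ≈⟨ ⊙-cong qP (ΣΔ-∷ (λ u v → complete u (λ j → χ (suc j) v)) a w) ⟨
    qP ⊙ 𝕋 (χ ∘ suc) (a ∷ w) ∎))

  𝔹-cong : ∀ {χ χ′} w → (∀ i v → χ i v ≈ χ′ i v) → 𝔹 χ w ≈ 𝔹 χ′ w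
  𝔹-cong w e = ΣΔ-cong w (λ u v → ⊙-cong (-1P ^P sum u) (⊙-cong ((u ==W replicate (sum u) 1) 1P) (e (sum u) v)))

  𝕋-cong : ∀ {χ χ′} w → (∀ i v → χ i v ≈ χ′ i v) → 𝕋 χ w ≈ 𝕋 χ′ w
  𝕋-cong w e = ΣΔ-cong w (λ u v → ⊙-cong (qP ^P sum u) (e (sum u) v))

  𝕋-⊕ : ∀ χ χ′ w → 𝕋 (λ i v → χ i v ⊕ χ′ i v) w ≈ 𝕋 χ w ⊕ 𝕋 χ′ w
  𝕋-⊕ χ χ′ w = ≈ᴹ-trans (ΣΔ-cong w (λ u v → ⊙-distribˡ (qP ^P sum u) _ _)) (Σ-⊕ (Δw w) _ _)

  cons0-▹ : ∀ a w s → cons0 a (w ▹ s) ≡ cons0 a w ▹ s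
  cons0-▹ zero    w s = refl
  cons0-▹ (suc a) w s = refl

  -- The coproduct recurses from the front while the letter of interest is the last one. Leading
  -- letters are absorbed into an arbitrary `χ`; the splittings of the first and last letters
  -- commute, up to `interchange`.
  𝔹-▹ : ∀ χ w s → 𝔹 χ (w ▹ suc s) ≈
        𝔹 (λ i v → χ i (v ▹ suc s)) w ⊕ -1P ⊙ 𝔹 (λ i v → χ (suc i) (v ▹ s)) w
  𝔹-▹ χ []          s = 𝔹-suc∷ χ s []
  𝔹-▹ χ (zero ∷ w)  s = begin
    𝔹 χ (0 ∷ (w ▹ suc s))  ≈⟨ ΣΔ-0∷ _ (w ▹ suc s) ⟩
    𝔹 χ (w ▹ suc s)        ≈⟨ 𝔹-▹ χ w s ⟩
    𝔹 (λ i v → χ i (v ▹ suc s)) w ⊕ -1P ⊙ 𝔹 (λ i v → χ (suc i) (v ▹ s)) w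
      ≈⟨ +ᴹ-cong (ΣΔ-0∷ _ w) (⊙-cong -1P (ΣΔ-0∷ _ w)) ⟨
    𝔹 (λ i v → χ i (v ▹ suc s)) (0 ∷ w) ⊕ -1P ⊙ 𝔹 (λ i v → χ (suc i) (v ▹ s)) (0 ∷ w) ∎
  𝔹-▹ χ (suc a ∷ w) s = begin
    𝔹 χ (suc a ∷ (w ▹ suc s))
      ≈⟨ 𝔹-suc∷ χ a (w ▹ suc s) ⟩
    𝔹 χa (w ▹ suc s) ⊕ -1P ⊙ 𝔹 χa⁻ (w ▹ suc s)
      ≈⟨ +ᴹ-cong (𝔹-▹ χa w s) (⊙-cong -1P (𝔹-▹ χa⁻ w s)) ⟩
    (A ⊕ -1P ⊙ C) ⊕ -1P ⊙ (B₁ ⊕ -1P ⊙ D₁)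
      ≈⟨ ⊕-congˡ (⊙-distribˡ -1P _ _) ⟩
    (A ⊕ -1P ⊙ C) ⊕ (-1P ⊙ B₁ ⊕ -1P ⊙ -1P ⊙ D₁)
      ≈⟨ interchange _ _ _ _ ⟩
    (A ⊕ -1P ⊙ B₁) ⊕ (-1P ⊙ C ⊕ -1P ⊙ -1P ⊙ D₁)
      ≈⟨ ⊕-congˡ (⊙-distribˡ -1P _ _) ⟨
    (A ⊕ -1P ⊙ B₁) ⊕ -1P ⊙ (C ⊕ -1P ⊙ D₁)
      ≈⟨ +ᴹ-cong (⊕-congˡ (⊙-cong -1P (𝔹-cong w (λ i v → ≈ᴹ-reflexive (cong (χ (suc i)) (cons0-▹ a v (suc s)))))))
                 (⊙-cong -1P (⊕-congˡ (⊙-cong -1P (𝔹-cong w (λ i v → ≈ᴹ-reflexive (cong (χ (suc (suc i))) (cons0-▹ a v s))))))) ⟩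
    (A ⊕ -1P ⊙ B₂) ⊕ -1P ⊙ (C ⊕ -1P ⊙ D₂)
      ≈⟨ +ᴹ-cong (𝔹-suc∷ (λ i v → χ i (v ▹ suc s)) a w) (⊙-cong -1P (𝔹-suc∷ (λ i v → χ (suc i) (v ▹ s)) a w)) ⟨
    𝔹 (λ i v → χ i (v ▹ suc s)) (suc a ∷ w) ⊕ -1P ⊙ 𝔹 (λ i v → χ (suc i) (v ▹ s)) (suc a ∷ w) ∎
    where
    χa χa⁻ : ℕ → Word → M
    χa  i v = χ i (suc a ∷ v)
    χa⁻ i v = χ (suc i) (cons0 a v)
    A B₁ B₂ C D₁ D₂ : M
    A  = 𝔹 (λ i v → χ i (suc a ∷ v ▹ suc s)) w
    B₁ = 𝔹 (λ i v → χ (suc i) (cons0 a (v ▹ suc s))) w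
    B₂ = 𝔹 (λ i v → χ (suc i) (cons0 a v ▹ suc s)) w
    C  = 𝔹 (λ i v → χ (suc i) (suc a ∷ v ▹ s)) w
    D₁ = 𝔹 (λ i v → χ (suc (suc i)) (cons0 a (v ▹ s))) w
    D₂ = 𝔹 (λ i v → χ (suc (suc i)) (cons0 a v ▹ s)) w

  -- Same interplay as for `𝔹-▹`, but the induction also descends to the word whose first letter is
  -- lowered by one.
  𝕋-▹ : ∀ χ w s → 𝕋 χ (w ▹ suc s) ≈ 𝕋 (λ i v → χ i (v ▹ suc s)) w ⊕ qP ⊙ 𝕋 (χ ∘ suc) (w ▹ s)
  -- `𝕋-suc∷` leaves the letter 0 behind, whereas `[] ▹ 0` is empty.
  𝕋-▹ χ []          zero    = ≈ᴹ-trans (𝕋-suc∷ χ 0 []) (⊕-congˡ (⊙-cong qP (ΣΔ-0∷ (λ u v → complete u (λ i → χ (suc i) v)) [])))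
  𝕋-▹ χ []          (suc s) = 𝕋-suc∷ χ (suc s) []
  𝕋-▹ χ (zero ∷ w)  s = begin
    𝕋 χ (0 ∷ (w ▹ suc s))  ≈⟨ ΣΔ-0∷ _ (w ▹ suc s) ⟩
    𝕋 χ (w ▹ suc s)        ≈⟨ 𝕋-▹ χ w s ⟩
    𝕋 (λ i v → χ i (v ▹ suc s)) w ⊕ qP ⊙ 𝕋 (χ ∘ suc) (w ▹ s)
      ≈⟨ +ᴹ-cong (ΣΔ-0∷ _ w) (⊙-cong qP (ΣΔ-0∷ _ (w ▹ s))) ⟨
    𝕋 (λ i v → χ i (v ▹ suc s)) (0 ∷ w) ⊕ qP ⊙ 𝕋 (χ ∘ suc) (0 ∷ (w ▹ s)) ∎
  𝕋-▹ χ (suc a ∷ w) s = begin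
    𝕋 χ (suc a ∷ (w ▹ suc s))
      ≈⟨ 𝕋-suc∷ χ a (w ▹ suc s) ⟩
    𝕋 (λ i v → χ i (suc a ∷ v)) (w ▹ suc s) ⊕ qP ⊙ 𝕋 (χ ∘ suc) (a ∷ w ▹ suc s)
      ≈⟨ +ᴹ-cong (𝕋-▹ (λ i v → χ i (suc a ∷ v)) w s) (⊙-cong qP (𝕋-▹ (χ ∘ suc) (a ∷ w) s)) ⟩
    (A ⊕ qP ⊙ B₁) ⊕ qP ⊙ (C ⊕ qP ⊙ D₁)
      ≈⟨ ⊕-congˡ (⊙-distribˡ qP _ _) ⟩
    (A ⊕ qP ⊙ B₁) ⊕ (qP ⊙ C ⊕ qP ⊙ qP ⊙ D₁)
      ≈⟨ interchange _ _ _ _ ⟩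
    (A ⊕ qP ⊙ C) ⊕ (qP ⊙ B₁ ⊕ qP ⊙ qP ⊙ D₁)
      ≈⟨ ⊕-congˡ (⊙-distribˡ qP _ _) ⟨
    (A ⊕ qP ⊙ C) ⊕ qP ⊙ (B₁ ⊕ qP ⊙ D₁)
      ≈⟨ +ᴹ-cong (𝕋-suc∷ (λ i v → χ i (v ▹ suc s)) a w) (⊙-cong qP (𝕋-suc∷ (χ ∘ suc) a (w ▹ s))) ⟨
    𝕋 (λ i v → χ i (v ▹ suc s)) (suc a ∷ w) ⊕ qP ⊙ 𝕋 (χ ∘ suc) (suc a ∷ (w ▹ s)) ∎
    where
    A B₁ C D₁ : M
    A  = 𝕋 (λ i v → χ i (suc a ∷ v ▹ suc s)) w
    B₁ = 𝕋 (λ i v → χ (suc i) (suc a ∷ v)) (w ▹ s)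
    C  = 𝕋 (λ i v → χ (suc i) (v ▹ suc s)) (a ∷ w)
    D₁ = 𝕋 (λ i v → χ (suc (suc i)) v) (a ∷ w ▹ s)

  -- The operators against right multiplication by H_s.

  H-▹ : ∀ k ψ w s → H[ k ] ψ (w ▹ s) ≡ H[ k ] (λ v → ψ (v ▹ s)) w
  H-▹ (+ k)    ψ w s = cong ψ (cons0-▹ k w s)
  H-▹ -[1+ k ] ψ w s = refl

  +-suc-shift : ∀ m i → m ℤ.+ + suc i ≡ (m ℤ.+ 1ℤ) ℤ.+ + i
  +-suc-shift m i = ≡.sym (ℤ.+-assoc m 1ℤ (+ i))

  -- The second series of `𝔹-▹`, reindexed by one, is that of B_{m+1}. Its sign -1 makes it cancel
  -- against the summand added on the left.
  B*-▹ : ∀ m ψ w s → B* m ψ (w ▹ suc s) ⊕ B* (m ℤ.+ 1ℤ) (λ v → ψ (v ▹ s)) w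
                     ≈ B* m (λ v → ψ (v ▹ suc s)) w
  B*-▹ m ψ w s = begin
    B* m ψ (w ▹ suc s) ⊕ B* (m ℤ.+ 1ℤ) ψs w
      ≈⟨ +ᴹ-cong (⟦⟧-Bw ψ m (w ▹ suc s)) (⟦⟧-Bw ψs (m ℤ.+ 1ℤ) w) ⟩
    𝔹 (λ i → H[ m ℤ.+ + i ] ψ) (w ▹ suc s) ⊕ E
      ≈⟨ ⊕-congʳ (𝔹-▹ (λ i → H[ m ℤ.+ + i ] ψ) w s) ⟩
    (𝔹 (λ i v → H[ m ℤ.+ + i ] ψ (v ▹ suc s)) w ⊕ -1P ⊙ 𝔹 (λ i v → H[ m ℤ.+ + suc i ] ψ (v ▹ s)) w) ⊕ E
      ≈⟨ ⊕-congʳ (+ᴹ-cong (𝔹-cong w (λ i v → ≈ᴹ-reflexive (H-▹ (m ℤ.+ + i) ψ v (suc s))))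
           (⊙-cong -1P (𝔹-cong w (λ i v → ≈ᴹ-reflexive (≡.trans (H-▹ (m ℤ.+ + suc i) ψ v s)
             (cong (λ k → H[ k ] ψs v) (+-suc-shift m i))))))) ⟩
    (𝔹 (λ i → H[ m ℤ.+ + i ] ψSs) w ⊕ -1P ⊙ E) ⊕ E
      ≈⟨ +ᴹ-assoc _ _ _ ⟩
    𝔹 (λ i → H[ m ℤ.+ + i ] ψSs) w ⊕ (-1P ⊙ E ⊕ E)
      ≈⟨ ⊕-congˡ (-1P-⊙-inverse E) ⟩
    𝔹 (λ i → H[ m ℤ.+ + i ] ψSs) w ⊕ 𝟎
      ≈⟨ +ᴹ-identityʳ _ ⟩
    𝔹 (λ i → H[ m ℤ.+ + i ] ψSs) w
      ≈⟨ ⟦⟧-Bw ψSs m w ⟨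
    B* m ψSs w ∎
    where
    ψs ψSs : Word → M
    ψs  v = ψ (v ▹ s)
    ψSs v = ψ (v ▹ suc s)
    E : M
    E = 𝔹 (λ i → H[ (m ℤ.+ 1ℤ) ℤ.+ + i ] ψs) w

  -- The B̃_{m+1} summand on the left is what `B*-▹`, applied at m+i under the coproduct sum, needs
  -- in order to pull H_{s+1} out of B_{m+i}. The q-term of `𝕋-▹` passes through with its index
  -- shifted.
  T*-▹ : ∀ m ψ w s → T* m ψ (w ▹ suc s) ⊕ T* (m ℤ.+ 1ℤ) (λ v → ψ (v ▹ s)) w
                     ≈ T* m (λ v → ψ (v ▹ suc s)) w ⊕ qP ⊙ T* (m ℤ.+ 1ℤ) ψ (w ▹ s)
  T*-▹ m ψ w s = begin
    T* m ψ (w ▹ suc s) ⊕ T* m⁺ ψs w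
      ≈⟨ +ᴹ-cong (⟦⟧-Btw ψ m (w ▹ suc s)) (⟦⟧-Btw ψs m⁺ w) ⟩
    𝕋 β (w ▹ suc s) ⊕ 𝕋 β⁺s w
      ≈⟨ ⊕-congʳ (𝕋-▹ β w s) ⟩
    (𝕋 (λ i v → β i (v ▹ suc s)) w ⊕ qP ⊙ 𝕋 (β ∘ suc) (w ▹ s)) ⊕ 𝕋 β⁺s w
      ≈⟨ +ᴹ-assoc _ _ _ ⟩
    𝕋 (λ i v → β i (v ▹ suc s)) w ⊕ (qP ⊙ 𝕋 (β ∘ suc) (w ▹ s) ⊕ 𝕋 β⁺s w)
      ≈⟨ ⊕-congˡ (+ᴹ-comm _ _) ⟩
    𝕋 (λ i v → β i (v ▹ suc s)) w ⊕ (𝕋 β⁺s w ⊕ qP ⊙ 𝕋 (β ∘ suc) (w ▹ s))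
      ≈⟨ +ᴹ-assoc _ _ _ ⟨
    (𝕋 (λ i v → β i (v ▹ suc s)) w ⊕ 𝕋 β⁺s w) ⊕ qP ⊙ 𝕋 (β ∘ suc) (w ▹ s)
      ≈⟨ +ᴹ-cong (≈ᴹ-sym (𝕋-⊕ (λ i v → β i (v ▹ suc s)) β⁺s w))
                 (⊙-cong qP (𝕋-cong (w ▹ s) (λ i v → ≈ᴹ-reflexive (cong (λ k → B* k ψ v) (+-suc-shift m i))))) ⟩
    𝕋 (λ i v → β i (v ▹ suc s) ⊕ β⁺s i v) w ⊕ qP ⊙ 𝕋 (λ i → B* (m⁺ ℤ.+ + i) ψ) (w ▹ s)
      ≈⟨ +ᴹ-cong (𝕋-cong w (λ i v → ≈ᴹ-trans
           (⊕-congˡ (≈ᴹ-reflexive (cong (λ k → B* k ψs v) (shift-comm m i))))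
           (B*-▹ (m ℤ.+ + i) ψ v s)))
           (⊙-cong qP (≈ᴹ-sym (⟦⟧-Btw ψ m⁺ (w ▹ s)))) ⟩
    𝕋 (λ i → B* (m ℤ.+ + i) (λ v → ψ (v ▹ suc s))) w ⊕ qP ⊙ T* m⁺ ψ (w ▹ s)
      ≈⟨ ⊕-congʳ (⟦⟧-Btw (λ v → ψ (v ▹ suc s)) m w) ⟨
    T* m (λ v → ψ (v ▹ suc s)) w ⊕ qP ⊙ T* m⁺ ψ (w ▹ s) ∎
    where
    m⁺ = m ℤ.+ 1ℤ
    ψs : Word → M
    ψs v = ψ (v ▹ s)
    β β⁺s : ℕ → Word → M
    β i = B* (m ℤ.+ + i) ψ
    β⁺s i = B* (m⁺ ℤ.+ + i) ψs
    shift-comm : ∀ m i → (m ℤ.+ 1ℤ) ℤ.+ + i ≡ (m ℤ.+ + i) ℤ.+ 1ℤ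
    shift-comm m i = ≡.trans (ℤ.+-assoc m 1ℤ (+ i)) (≡.trans (cong (λ k → m ℤ.+ k) (ℤ.+-comm 1ℤ (+ i))) (≡.sym (ℤ.+-assoc m (+ i) 1ℤ)))

  -- One-row values, and the unrolling for a single operator.

  T*-[] : ∀ k ψ → T* (+ k) ψ [] ≈ ψ (cons0 k [])
  T*-[] k ψ = begin
    T* (+ k) ψ []                                     ≈⟨ ⟦⟧-Btw ψ (+ k) [] ⟩
    1P ⊙ B* (+ (k + 0)) ψ [] ⊕ 𝟎                      ≈⟨ ≈ᴹ-trans (+ᴹ-identityʳ _) (1P-⊙ _) ⟩
    B* (+ (k + 0)) ψ []                               ≈⟨ ⟦⟧-Bw ψ (+ (k + 0)) [] ⟩
    1P ⊙ 1P ⊙ ψ (cons0 (k + 0 + 0) []) ⊕ 𝟎            ≈⟨ ≈ᴹ-trans (+ᴹ-identityʳ _) (≈ᴹ-trans (1P-⊙ _) (1P-⊙ _)) ⟩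
    ψ (cons0 (k + 0 + 0) [])                          ≈⟨ ≈ᴹ-reflexive (cong (λ n → ψ (cons0 n []))
                                                           (≡.trans (ℕ.+-identityʳ (k + 0)) (ℕ.+-identityʳ k))) ⟩
    ψ (cons0 k [])                                    ∎

  ⟦⟧-Q′-∷ : ∀ ψ a α → ⟦ ψ ⟧ (Q' (a ∷ α)) ≈ ⟦ T* (+ a) ψ ⟧ (Q' α)
  ⟦⟧-Q′-∷ ψ a α = ⟦⟧-ext ψ (Btw (+ a)) (Q' α)

  ⟦⟧-Q′-row : ∀ ψ s → ⟦ ψ ⟧ (Q' (cons0 s [])) ≈ ψ (cons0 s [])
  ⟦⟧-Q′-row ψ zero    = ⟦⟧-basis ψ []
  ⟦⟧-Q′-row ψ (suc s) = ≈ᴹ-trans (⟦⟧-Q′-∷ ψ (suc s) []) (≈ᴹ-trans (⟦⟧-basis (T* (+ suc s) ψ) []) (T*-[] (suc s) ψ))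

  qP-⊙ : ∀ x → qP ⊙ x ≈ q x
  qP-⊙ x = ≈ᴹ-trans (0∷-⊙ 1P x) (q-cong (1P-⊙ x))

  ⊙-q : ∀ p x → p ⊙ q x ≈ q (p ⊙ x)
  ⊙-q []      x = ≈ᴹ-sym q-𝟎
  ⊙-q (a ∷ p) x = ≈ᴹ-trans (+ᴹ-cong (≈ᴹ-sym (q-· a x)) (q-cong (⊙-q p x))) (≈ᴹ-sym (q-⊕ _ _))

  ⊙-qP-comm : ∀ p x → p ⊙ qP ⊙ x ≈ qP ⊙ p ⊙ x
  ⊙-qP-comm p x = ≈ᴹ-trans (⊙-cong p (qP-⊙ x)) (≈ᴹ-trans (⊙-q p x) (≈ᴹ-sym (qP-⊙ (p ⊙ x))))

  ⟦⟧-qP : ∀ ψ f → ⟦ (λ w → qP ⊙ ψ w) ⟧ f ≈ qP ⊙ ⟦ ψ ⟧ f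
  ⟦⟧-qP ψ f = ≈ᴹ-trans (Σ-cong f (λ (c , w) → ⊙-qP-comm c (ψ w))) (Σ-⊙ qP f _)

  module Row (ψ : Word → M) (f : NSym) where

    -- The values of ψ at B̃_a(f H_s) and at B̃_a(f) H_s.
    inner outer : ℕ → ℕ → M
    inner a s = ⟦ (λ w → T* (+ a) ψ (w ▹ s)) ⟧ f
    outer a s = ⟦ T* (+ a) (λ w → ψ (w ▹ s)) ⟧ f

    outer-suc : ∀ a s → outer a (suc s) ⊕ qP ⊙ inner (suc a) s ≈ inner a (suc s) ⊕ outer (suc a) s
    outer-suc a s = begin
      outer a (suc s) ⊕ qP ⊙ inner (suc a) s
        ≈⟨ ⊕-congˡ (⟦⟧-qP (λ w → T* (+ suc a) ψ (w ▹ s)) f) ⟨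
      outer a (suc s) ⊕ ⟦ (λ w → qP ⊙ T* (+ suc a) ψ (w ▹ s)) ⟧ f
        ≈⟨ ⟦⟧-⊕ (T* (+ a) (λ w → ψ (w ▹ suc s))) (λ w → qP ⊙ T* (+ suc a) ψ (w ▹ s)) f ⟨
      ⟦ (λ w → T* (+ a) (λ v → ψ (v ▹ suc s)) w ⊕ qP ⊙ T* (+ suc a) ψ (w ▹ s)) ⟧ f
        ≈⟨ ⟦⟧-cong f pointwise ⟨
      ⟦ (λ w → T* (+ a) ψ (w ▹ suc s) ⊕ T* (+ suc a) (λ v → ψ (v ▹ s)) w) ⟧ f
        ≈⟨ ⟦⟧-⊕ (λ w → T* (+ a) ψ (w ▹ suc s)) (T* (+ suc a) (λ v → ψ (v ▹ s))) f ⟩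
      inner a (suc s) ⊕ outer (suc a) s ∎
      where
      pointwise : ∀ w → T* (+ a) ψ (w ▹ suc s) ⊕ T* (+ suc a) (λ v → ψ (v ▹ s)) w
                        ≈ T* (+ a) (λ v → ψ (v ▹ suc s)) w ⊕ qP ⊙ T* (+ suc a) ψ (w ▹ s)
      -- `+ a ℤ.+ 1ℤ` computes to `+ (a + 1)`, not to `+ suc a`.
      pointwise w = ≡.subst
        (λ k → T* (+ a) ψ (w ▹ suc s) ⊕ T* (+ k) (λ v → ψ (v ▹ s)) w
               ≈ T* (+ a) (λ v → ψ (v ▹ suc s)) w ⊕ qP ⊙ T* (+ k) ψ (w ▹ s))
        (ℕ.+-comm a 1) (T*-▹ (+ a) ψ w s)

    -- The sum of `inner (a + k) (s ∸ k)` over 1 ≤ k ≤ s, unfolded exactly as `longer` is.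
    inner-longer : ℕ → ℕ → M
    inner-longer a zero    = 𝟎
    inner-longer a (suc s) = inner (suc a) s ⊕ inner-longer (suc a) s

    outer-expand : ∀ a s → outer a s ≈ inner a s ⊕ 1-qP ⊙ inner-longer a s
    outer-expand a zero    = begin
      outer a 0                                  ≈⟨ ⟦⟧-cong f (λ w → Σ-cong (Btw (+ a) w) (λ (c , v) →
                                                      ⊙-cong c (≈ᴹ-reflexive (cong ψ (++-identityʳ v))))) ⟩
      ⟦ T* (+ a) ψ ⟧ f                           ≈⟨ ⟦⟧-cong f (λ w → ≈ᴹ-reflexive (cong (T* (+ a) ψ) (≡.sym (++-identityʳ w)))) ⟩
      inner a 0                                  ≈⟨ +ᴹ-identityʳ _ ⟨
      inner a 0 ⊕ 𝟎                              ≈⟨ ⊕-congˡ (⊙-zeroʳ 1-qP) ⟨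
      inner a 0 ⊕ 1-qP ⊙ 𝟎                       ∎
    -- Adding q X to both sides avoids subtraction: X comes with coefficient 1 from the induction
    -- hypothesis and is split as (1-q) X + q X.
    outer-expand a (suc s) = ∙-cancelʳ (qP ⊙ X) _ _ (begin
      outer a (suc s) ⊕ qP ⊙ X                              ≈⟨ outer-suc a s ⟩
      inner a (suc s) ⊕ outer (suc a) s                     ≈⟨ ⊕-congˡ (outer-expand (suc a) s) ⟩
      inner a (suc s) ⊕ (X ⊕ 1-qP ⊙ Y)                      ≈⟨ ⊕-congˡ (⊕-congʳ (1-qP-⊙-complement X)) ⟨
      inner a (suc s) ⊕ ((1-qP ⊙ X ⊕ qP ⊙ X) ⊕ 1-qP ⊙ Y)    ≈⟨ ⊕-congˡ (xy∙z≈xz∙y _ _ _) ⟩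
      inner a (suc s) ⊕ ((1-qP ⊙ X ⊕ 1-qP ⊙ Y) ⊕ qP ⊙ X)    ≈⟨ +ᴹ-assoc _ _ _ ⟨
      (inner a (suc s) ⊕ (1-qP ⊙ X ⊕ 1-qP ⊙ Y)) ⊕ qP ⊙ X    ≈⟨ ⊕-congʳ (⊕-congˡ (⊙-distribˡ 1-qP X Y)) ⟨
      (inner a (suc s) ⊕ 1-qP ⊙ (X ⊕ Y)) ⊕ qP ⊙ X           ∎)
      where
      X = inner (suc a) s
      Y = inner-longer (suc a) s

  -- Induction over the rows of α.

  weight : Word → (Word → M) → Word → M
  weight α ψ β = (1-qP ^P nrows α β) ⊙ ⟦ ψ ⟧ (Q' β)

  -- For each possible new first row b, the rows below are handled by the hypothesis at the
  -- functional `T* (+ b) ψ`; this is what forces ψ to be universally quantified.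
  Σ-pieri : ∀ α ψ s → ⟦ (λ w → ψ (w ▹ s)) ⟧ (Q' α) ≈ Σ (pieri α s) (weight α ψ)
  Σ-pieri []      ψ s = begin
    ⟦ (λ w → ψ (w ▹ s)) ⟧ (basis [])          ≈⟨ ⟦⟧-basis (λ w → ψ (w ▹ s)) [] ⟩
    ψ (cons0 s [])                            ≈⟨ ⟦⟧-Q′-row ψ s ⟨
    -- `nrows [] β` is 0, so a new last row contributes no factor 1-q.
    ⟦ ψ ⟧ (Q' (cons0 s []))                   ≈⟨ 1P-⊙ _ ⟨
    1P ⊙ ⟦ ψ ⟧ (Q' (cons0 s []))              ≈⟨ +ᴹ-identityʳ _ ⟨
    1P ⊙ ⟦ ψ ⟧ (Q' (cons0 s [])) ⊕ 𝟎          ∎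
  Σ-pieri (a ∷ α) ψ s = begin
    ⟦ (λ w → ψ (w ▹ s)) ⟧ (Q' (a ∷ α))
      ≈⟨ ⟦⟧-Q′-∷ (λ w → ψ (w ▹ s)) a α ⟩
    outer a s
      ≈⟨ outer-expand a s ⟩
    inner a s ⊕ 1-qP ⊙ inner-longer a s
      ≈⟨ +ᴹ-cong (row a s (λ β → ⊙-exp (nrows-∷-≡ a α β) _)) (Σ-longer a s ℕ.≤-refl) ⟩
    Σ (map (a ∷_) (pieri α s)) (weight (a ∷ α) ψ) ⊕ Σ (longer (pieri α) a s) (weight (a ∷ α) ψ)
      ≈⟨ Σ-++ (map (a ∷_) (pieri α s)) _ _ ⟨
    Σ (pieri (a ∷ α) s) (weight (a ∷ α) ψ) ∎
    where
    open Row ψ (Q' α)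
    ⊙-exp : ∀ {m n} → m ≡ n → ∀ x → (1-qP ^P n) ⊙ x ≈ (1-qP ^P m) ⊙ x
    ⊙-exp refl x = ≈ᴹ-refl
    inner-Σ : ∀ b s → inner b s ≈ Σ (pieri α s) (λ β → (1-qP ^P nrows α β) ⊙ ⟦ ψ ⟧ (Q' (b ∷ β)))
    inner-Σ b s = ≈ᴹ-trans (Σ-pieri α (T* (+ b) ψ) s)
      (Σ-cong (pieri α s) (λ β → ⊙-cong (1-qP ^P nrows α β) (≈ᴹ-sym (⟦⟧-Q′-∷ ψ b β))))
    row : ∀ b s → (∀ β → (1-qP ^P nrows α β) ⊙ ⟦ ψ ⟧ (Q' (b ∷ β)) ≈ weight (a ∷ α) ψ (b ∷ β)) →
          inner b s ≈ Σ (map (b ∷_) (pieri α s)) (weight (a ∷ α) ψ)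
    row b s e = ≈ᴹ-trans (inner-Σ b s) (≈ᴹ-trans (Σ-cong (pieri α s) e) (≈ᴹ-sym (Σ-map (b ∷_) (pieri α s) _)))
    row-longer : ∀ b s → a < b → 1-qP ⊙ inner b s ≈ Σ (map (b ∷_) (pieri α s)) (weight (a ∷ α) ψ)
    row-longer b s a<b = begin
      1-qP ⊙ inner b s
        ≈⟨ ⊙-cong 1-qP (inner-Σ b s) ⟩
      1-qP ⊙ Σ (pieri α s) (λ β → (1-qP ^P nrows α β) ⊙ ⟦ ψ ⟧ (Q' (b ∷ β)))
        ≈⟨ Σ-⊙ 1-qP (pieri α s) _ ⟨
      Σ (pieri α s) (λ β → 1-qP ⊙ (1-qP ^P nrows α β) ⊙ ⟦ ψ ⟧ (Q' (b ∷ β)))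
        -- The 1-q from the unrolling is the factor that `nrows` counts for the lengthened first
        -- row.
        ≈⟨ Σ-cong (pieri α s) (λ β → ≈ᴹ-trans (≈ᴹ-sym (*P-⊙ 1-qP (1-qP ^P nrows α β) _)) (⊙-exp (nrows-∷-< a<b α β) _)) ⟩
      Σ (pieri α s) (λ β → weight (a ∷ α) ψ (b ∷ β))
        ≈⟨ Σ-map (b ∷_) (pieri α s) _ ⟨
      Σ (map (b ∷_) (pieri α s)) (weight (a ∷ α) ψ) ∎
    -- Weights compare with the fixed row `a` while `b` climbs, hence the invariant a ≤ b.
    Σ-longer : ∀ b s → a ≤ b → 1-qP ⊙ inner-longer b s ≈ Σ (longer (pieri α) b s) (weight (a ∷ α) ψ)
    Σ-longer b zero    a≤b = ⊙-zeroʳ 1-qP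
    Σ-longer b (suc s) a≤b = begin
      1-qP ⊙ (inner (suc b) s ⊕ inner-longer (suc b) s)
        ≈⟨ ⊙-distribˡ 1-qP _ _ ⟩
      1-qP ⊙ inner (suc b) s ⊕ 1-qP ⊙ inner-longer (suc b) s
        ≈⟨ +ᴹ-cong (row-longer (suc b) s (s≤s a≤b)) (Σ-longer (suc b) s (ℕ.m≤n⇒m≤1+n a≤b)) ⟩
      Σ (map (suc b ∷_) (pieri α s)) (weight (a ∷ α) ψ) ⊕ Σ (longer (pieri α) (suc b) s) (weight (a ∷ α) ψ)
        ≈⟨ Σ-++ (map (suc b ∷_) (pieri α s)) _ _ ⟨
      Σ (longer (pieri α) b (suc s)) (weight (a ∷ α) ψ) ∎

-- Coefficient sequences as values, and the conclusion.

sequenceModule : ℤ[q]-Module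
sequenceModule = record
  { leftModule = record
    { Carrierᴹ = ℕ → ℤ
    -- On coefficient sequences this is `_≈P_`, so trailing zeros of coefficient lists are
    -- invisible.
    ; _≈ᴹ_ = λ x y → ∀ n → x n ≡ y n
    ; _+ᴹ_ = λ x y n → x n ℤ.+ y n
    ; _*ₗ_ = λ a x n → a ℤ.* x n
    ; 0ᴹ   = λ n → 0ℤ
    ; -ᴹ_  = λ x n → ℤ.- x n
    ; isLeftModule = record
      { isLeftSemimodule = record
        { +ᴹ-isCommutativeMonoid = isCommutativeMonoid ℕ ℤ.+-0-isCommutativeMonoid
        ; isPreleftSemimodule = record
          { *ₗ-cong      = λ { {a} refl e n → cong (a ℤ.*_) (e n) }
          ; *ₗ-zeroˡ     = λ x n → ℤ.*-zeroˡ (x n)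
          ; *ₗ-distribʳ  = λ x a b n → ℤ.*-distribʳ-+ (x n) a b
          ; *ₗ-identityˡ = λ x n → ℤ.*-identityˡ (x n)
          ; *ₗ-assoc     = λ a b x n → ℤ.*-assoc a b (x n)
          ; *ₗ-zeroʳ     = λ a n → ℤ.*-zeroʳ a
          ; *ₗ-distribˡ  = λ a x y n → ℤ.*-distribˡ-+ a (x n) (y n)
          }
        }
      ; -ᴹ‿cong    = λ e n → cong ℤ.-_ (e n)
      ; -ᴹ‿inverse = (λ x n → ℤ.+-inverseˡ (x n)) , (λ x n → ℤ.+-inverseʳ (x n))
      }
    }
  ; q      = shift
  ; q-cong = λ { e zero → refl ; e (suc n) → e n }
  ; q-⊕    = λ { x y zero → refl ; x y (suc n) → refl }
  ; q-·    = λ { a x zero → ≡.sym (ℤ.*-zeroʳ a) ; a x (suc n) → refl }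
  }
  where
  shift : (ℕ → ℤ) → ℕ → ℤ
  shift x zero    = 0ℤ
  shift x (suc n) = x n

open Functionals sequenceModule

coeffP-+P : ∀ p r n → coeffP (p +P r) n ≡ coeffP p n ℤ.+ coeffP r n
coeffP-+P []      r       n       = ≡.sym (ℤ.+-identityˡ _)
coeffP-+P (a ∷ p) []      n       = ≡.sym (ℤ.+-identityʳ _)
coeffP-+P (a ∷ p) (b ∷ r) zero    = refl
coeffP-+P (a ∷ p) (b ∷ r) (suc n) = coeffP-+P p r n

⊙-coeffP-1P : ∀ p n → (p ⊙ coeffP 1P) n ≡ coeffP p n
⊙-coeffP-1P []      n       = refl
⊙-coeffP-1P (a ∷ p) zero    = ≡.trans (ℤ.+-identityʳ _) (ℤ.*-identityʳ a)
⊙-coeffP-1P (a ∷ p) (suc n) = ≡.trans (cong₂ ℤ._+_ (ℤ.*-zeroʳ a) (⊙-coeffP-1P p n)) (ℤ.+-identityˡ _)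

-- The functional extracting the coefficient of H_w; together these decide `_≈N_`.
coordinate : Word → Word → ℕ → ℤ
coordinate w v = coeffP ((v ==W w) 1P)

coeffP-==W : ∀ c v w n → coeffP ((v ==W w) c) n ≡ (c ⊙ coordinate w v) n
coeffP-==W c v w n with ≡-dec ℕ._≟_ v w
... | yes _ = ≡.sym (⊙-coeffP-1P c n)
... | no _  = ≡.sym (⊙-zeroʳ c n)

coeffN-⟦⟧ : ∀ f w n → coeffP (coeffN f w) n ≡ ⟦ coordinate w ⟧ f n
coeffN-⟦⟧ []            w n = refl
coeffN-⟦⟧ ((c , v) ∷ f) w n =
  ≡.trans (coeffP-+P ((v ==W w) c) _ n) (cong₂ ℤ._+_ (coeffP-==W c v w n) (coeffN-⟦⟧ f w n))

theorem4p8 : (α : Word) → All (0 <_) α → (s : ℕ) →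
    (βs : List Word) → Unique βs →
    (∀ β → (β ∈ βs) ⇔ (All (0 <_) β × α ⊂[ s ] β)) →
    (Q' α *N H (+ s)) ≈N sumN (map (λ β → (1-qP ^P nrows α β) ·N Q' β) βs)
theorem4p8 α α>0 s βs βs-unique βs-spec w n = begin
  coeffP (coeffN (Q' α *N H (+ s)) w) n       ≡⟨ coeffN-⟦⟧ (Q' α *N H (+ s)) w n ⟩
  ⟦ ψ ⟧ (Q' α *N H (+ s)) n                   ≡⟨ ⟦⟧-*H ψ (Q' α) s n ⟩
  ⟦ (λ v → ψ (v ▹ s)) ⟧ (Q' α) n              ≡⟨ Σ-pieri α ψ s n ⟩
  Σ (pieri α s) (weight α ψ) n                ≡⟨ Σ-↭ (weight α ψ) βs↭pieri n ⟨
  Σ βs (weight α ψ) n                         ≡⟨ Σ-cong βs (λ β → ⟦⟧-· ψ (1-qP ^P nrows α β) (Q' β)) n ⟨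
  Σ βs (λ β → ⟦ ψ ⟧ (term β)) n               ≡⟨ ⟦⟧-sumN ψ term βs n ⟨
  ⟦ ψ ⟧ (sumN (map term βs)) n                ≡⟨ coeffN-⟦⟧ (sumN (map term βs)) w n ⟨
  coeffP (coeffN (sumN (map term βs)) w) n    ∎
  where
  open ≡.≡-Reasoning
  ψ = coordinate w
  term : Word → NSym
  term β = (1-qP ^P nrows α β) ·N Q' β
  βs↭pieri : βs ↭ pieri α s
  -- Both lists are free of repetitions and have the same members, so each is a permutation of the
  -- other.
  βs↭pieri = ∼bag⇒↭ (unique∧set⇒bag βs-unique (pieri-unique α s) (λ {β} → mk⇔
    (λ β∈ → let β>0 , α⊂β = Equivalence.to (βs-spec β) β∈ in pieri-complete s α>0 β>0 α⊂β)
    (λ β∈ → Equivalence.from (βs-spec β) (pieri-sound s α>0 β∈))))
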